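{- Let $p \geq 5$ be a prime. For $u \in \mathbb{F}_p$ let $K_u = \sum_{x=1}^{p-1} e_p(x + u x^{ -1})$, where $e_p(t) = \exp(2\pi i t/p)$ and $x^{ -1}$ is the inverse of $x$ modulo $p$, and let $V_6(p) = \sum_{u=1}^{p-1} K_u^6$. For $k \in \{2,3,\ldots,p-1\}$ with $k \not\equiv 9 \pmod p$, let $E_k$ be the elliptic curve over $\mathbb{F}_p$ given by $$y^2 = 4k x^3 + (k^2 - 6k - 3)x^2 + 4x,$$ and let $a_p(E_k) = p + 1 - |E_k(\mathbb{F}_p)|$ be its Frobenius trace, where $|E_k(\mathbb{F}_p)|$ counts the points including the point at infinity. Then $$V_6(p) = 4p^4 - 8p^3 + \left[4\left(\frac{p}{3}\right) + 2\right]p^2 - 5p - 1 + p^2 \sum_{\substack{k=2\\ k \not\equiv 9 \ (\mathrm{mod}\ p)}}^{p-1} \big(a_p(E_k) + 1\big)^2.$$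
   Context: $\left(\frac{\cdot}{\cdot}\right)$ denotes the Legendre symbol; $\left(\frac{p}{3}\right)$ is the Legendre symbol of $p$ modulo $3$. The values $k \equiv 1, 9 \pmod p$ are excluded because they give singular curves. -}

module Defs where

open import Data.Nat as ℕ using (ℕ; zero; suc; _∸_)
import Data.Nat.DivMod as ℕD
open import Data.Integer as ℤ using (ℤ; +_; _%ℕ_)
open import Data.Bool using (Bool; true; false; if_then_else_)
open import Data.Product using (∃)
open import Relation.Binary.PropositionalEquality using (_≡_)
open import Relation.Nullary.Decidable using (⌊_⌋)

-- reduction of natural numbers / integers modulo p (p = 0 : identity / absolute value;
-- only ever used with p prime)
modN : ℕ → ℕ → ℕ
modN zero    t = t
modN (suc q) t = t ℕD.% suc q

modZ : ℕ → ℤ → ℕ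
modZ zero    z = ℤ.∣ z ∣
modZ (suc q) z = z %ℕ suc q

_==_ : ℕ → ℕ → Bool
m == n = ⌊ m ℕ.≟ n ⌋

sumℕ : ℕ → (ℕ → ℤ) → ℤ
sumℕ zero    f = + 0
sumℕ (suc n) f = sumℕ n f ℤ.+ f n

sumFromTo : ℕ → ℕ → (ℕ → ℤ) → ℤ
sumFromTo a b f = sumℕ (suc b ∸ a) (λ i → f (a ℕ.+ i))

-- modular inverse: the least y ∈ {1,…,p-1} with x*y ≡ 1 (mod p)  (0 if none)
invSearch : ℕ → ℕ → ℕ → ℕ
invSearch p x zero    = 0
invSearch p x (suc n) =
  if modN p (x ℕ.* (p ∸ suc n)) == 1 then p ∸ suc n else invSearch p x n

inv : ℕ → ℕ → ℕ
inv p x = invSearch p x (p ∸ 1)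

-- The cyclotomic integers ℤ[ζ_p] = ℤ[C_p] / (Φ_p), with ζ_p = e_p(1).
-- An element of the group ring ℤ[C_p] is a function ℕ → ℤ, of which only
-- the values at 0,…,p-1 matter (coefficient of ζ^t).

GR : Set
GR = ℕ → ℤ

e : ℕ → ℕ → GR
e p t s = if s == modN p t then + 1 else + 0

constGR : ℕ → ℤ → GR
constGR p n s = if s == 0 then n else + 0

_⊕_ : GR → GR → GR
(f ⊕ g) s = f s ℤ.+ g s

sumGR : ℕ → ℕ → (ℕ → GR) → GR
sumGR a b F s = sumFromTo a b (λ i → F i s)

mul : ℕ → GR → GR → GR
mul p f g t = sumℕ p (λ a → f a ℤ.* g (modN p (t ℕ.+ (p ∸ a))))

pow : ℕ → GR → ℕ → GR
pow p f zero    = constGR p (+ 1)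
pow p f (suc n) = mul p f (pow p f n)

-- Φ_p(ζ) = 1 + ζ + … + ζ^{p-1}
Φ : GR
Φ s = + 1

-- equality in ℤ[ζ_p] = ℤ[C_p]/(Φ_p): the difference lies in the ideal (Φ_p)
_≈⟨_⟩_ : GR → ℕ → GR → Set
f ≈⟨ p ⟩ g = ∃ λ (h : GR) → ∀ t → t ℕ.< p → f t ℤ.- g t ≡ mul p Φ h t

K : ℕ → ℕ → GR
K p u = sumGR 1 (p ∸ 1) (λ x → e p (x ℕ.+ u ℕ.* inv p x))

V6 : ℕ → GR
V6 p = sumGR 1 (p ∸ 1) (λ u → pow p (K p u) 6)

rhsE : ℤ → ℤ → ℤ
rhsE k x = + 4 ℤ.* k ℤ.* x ℤ.* x ℤ.* x
         ℤ.+ (k ℤ.* k ℤ.- + 6 ℤ.* k ℤ.- + 3) ℤ.* x ℤ.* x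
         ℤ.+ + 4 ℤ.* x

numPoints : ℕ → ℕ → ℤ
numPoints p k =
  + 1 ℤ.+ sumℕ p (λ x → sumℕ p (λ y →
    if modZ p (+ y ℤ.* + y ℤ.- rhsE (+ k) (+ x)) == 0 then + 1 else + 0))

ap : ℕ → ℕ → ℤ
ap p k = + p ℤ.+ + 1 ℤ.- numPoints p k

legendre3 : ℕ → ℤ
legendre3 p with modN 3 p
... | 0 = + 0
... | 1 = + 1
... | _ = ℤ.- + 1

traceSum : ℕ → ℤ
traceSum p = sumFromTo 2 (p ∸ 1) (λ k →
  if modN p k == modN p 9 then + 0
  else (ap p k ℤ.+ + 1) ℤ.* (ap p k ℤ.+ + 1))

rhsV6 : ℕ → ℤ
rhsV6 p = let P = + p in
  + 4 ℤ.* P ℤ.* P ℤ.* P ℤ.* P ℤ.- + 8 ℤ.* P ℤ.* P ℤ.* P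
  ℤ.+ (+ 4 ℤ.* legendre3 p ℤ.+ + 2) ℤ.* P ℤ.* P
  ℤ.- + 5 ℤ.* P ℤ.- + 1
  ℤ.+ P ℤ.* P ℤ.* traceSum p

{-# OPTIONS --safe #-}

-- The coefficient of ζᵗ in ∑ᵤ Kᵤ⁶ counts the solutions of ∑ xᵢ + u ∑ xᵢ⁻¹ = t in nonzero x₁, …, x₆, u.
-- It is the same for all t ≠ 0 by scaling, so V₆ is an integer, determined by the number of
-- (x₁, …, x₆) with ∑ xᵢ = ∑ xᵢ⁻¹ = 0. Splitting such a tuple into two triples, that number becomes a sum
-- of squares of n(k) = #{x + y + z = 1, x⁻¹ + y⁻¹ + z⁻¹ = k}. Fixing z leaves a quadratic equation
-- whose discriminant is, up to squares and a Möbius substitution, the right-hand side of the equation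
-- of E_k, which gives n(k) = |E_k(F_p)| - 6 = p - 4 - (a_p(E_k) + 1) for k ≠ 0, 1. The values n(0), n(1), n(9)
-- are computed directly, and ∑ n(k) supplies the first moment of a_p(E_k) + 1.
module Submission where

open import Defs
open import Data.Nat using (ℕ; _≤_)
open import Data.Nat.Primality using (Prime)

open import Algebra.Bundles using (CommutativeRing)
import Algebra.Properties.Semiring.Sum
import Algebra.Solver.Ring
open import Algebra.Solver.Ring.AlmostCommutativeRing
  using (AlmostCommutativeRing; fromCommutativeRing; _-Raw-AlmostCommutative⟶_)
open import Data.Bool using (if_then_else_)
open import Data.Fin using (Fin; toℕ; fromℕ<; punchIn)
open import Data.Fin.Permutation using (permutation)
import Data.Fin.Properties as Fin
open import Data.Integer as ℤ using (ℤ; +_; _+_; _*_; _-_; -_; _^_; _%ℕ_; _/ℕ_)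
import Data.Integer.DivMod as ℤ
open import Data.Integer.Divisibility.Signed as ℤ using (_∣_; divides)
import Data.Integer.Properties as ℤ
open import Data.Integer.Tactic.RingSolver using (solve-∀)
open import Data.Maybe using (Maybe; just; nothing)
open import Data.Nat as ℕ using (zero; suc; _∸_; s≤s; z≤n)
open import Data.Nat.Coprimality using (prime⇒coprime; coprime-Bézout)
import Data.Nat.Divisibility as ℕ
import Data.Nat.DivMod as ℕ
open import Data.Nat.GCD using (module Bézout)
import Data.Nat.Properties as ℕ
open import Data.Product using (_,_; ∃; _×_; proj₁; proj₂)
open import Data.Sum as Sum using (_⊎_; inj₁; inj₂)
open import Function using (_∘_; id)
open import Relation.Binary.Definitions using (Tri; tri<; tri≈; tri>)
open import Relation.Binary.PropositionalEquality
open import Relation.Nullary using (¬_; Dec; yes; no; contradiction)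
open import Relation.Nullary.Decidable using (⌊_⌋)

-- Modulo 1 + ζ + ... + ζ^(p-1), a group ring element with coefficient A at 0 and B at every other
-- exponent equals the integer A - B, so the goal becomes the value of `V 0# - V 1#` and no complex
-- number occurs. The quadratic character is likewise replaced by the number of square roots, which
-- turns character sums into changes of variable in finite sums. To keep these free of side
-- conditions, inversion is total with 0⁻¹ = 0 and permutes the whole field; the weight `ν` removes
-- zero where needed. The symbol (p/3) comes from the degenerate counts: for k = 0, for k = 9 and
-- for triples with both sums zero, a discriminant specialises to -3, and the number `ρ` of square
-- roots of -3 appears. Instead of quadratic reciprocity, an action of order 3 with `ρ` fixed points
-- on the p - 2 elements other than 0 and 1 identifies `ρ` with 1 + (p/3). The values k = 0, 1, 9,
-- absent from the trace sum, are added back so that moments can be taken over all k at once.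

private module S = Algebra.Properties.Semiring.Sum ℤ.+-*-semiring

-- Residues modulo p as a quotient ring of the integers

module Residues (q : ℕ) where

  p : ℕ
  p = suc q

  F : Set
  F = Fin p

  _≟_ : (x y : F) → Dec (x ≡ y)
  _≟_ = Fin._≟_

  toℤ : F → ℤ
  toℤ x = + toℕ x

  opaque
    ⟦_⟧ : ℤ → F
    ⟦ z ⟧ = fromℕ< (ℤ.n%ℕd<d z p)

    toℕ-⟦⟧ : ∀ z → toℕ ⟦ z ⟧ ≡ z %ℕ p
    toℕ-⟦⟧ z = Fin.toℕ-fromℕ< (ℤ.n%ℕd<d z p)

  ⟦⟧-residue : ∀ z → z ≡ toℤ ⟦ z ⟧ + (z /ℕ p) * + p
  ⟦⟧-residue z = trans (ℤ.a≡a%ℕn+[a/ℕn]*n z p)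
    (cong (λ r → + r + (z /ℕ p) * + p) (sym (toℕ-⟦⟧ z)))

  ⟦⟧≡⇒∣ : ∀ {a b} → ⟦ a ⟧ ≡ ⟦ b ⟧ → + p ∣ a - b
  ⟦⟧≡⇒∣ {a} {b} eq = divides (a /ℕ p - b /ℕ p) (begin
    a - b
      ≡⟨ cong₂ _-_ (⟦⟧-residue a) (⟦⟧-residue b) ⟩
    (toℤ ⟦ a ⟧ + (a /ℕ p) * + p) - (toℤ ⟦ b ⟧ + (b /ℕ p) * + p)
      ≡⟨ cong (λ r → (toℤ r + (a /ℕ p) * + p) - (toℤ ⟦ b ⟧ + (b /ℕ p) * + p)) eq ⟩
    (toℤ ⟦ b ⟧ + (a /ℕ p) * + p) - (toℤ ⟦ b ⟧ + (b /ℕ p) * + p)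
      ≡⟨ collect (toℤ ⟦ b ⟧) (a /ℕ p) (b /ℕ p) (+ p) ⟩
    (a /ℕ p - b /ℕ p) * + p ∎)
    where
    open ≡-Reasoning
    collect : ∀ r u v w → (r + u * w) - (r + v * w) ≡ (u - v) * w
    collect = solve-∀

  -- Two representatives in [0, p) differ by less than p in absolute value, and 0 is the only
  -- multiple of p that small.
  ∣⇒toℕ≡ : ∀ {x y : F} → + p ∣ toℤ x - toℤ y → x ≡ y
  ∣⇒toℕ≡ {x} {y} p∣ = Fin.toℕ-injective (ℤ.+-injective (ℤ.i-j≡0⇒i≡j _ _ (ℤ.∣i∣≡0⇒i≡0
    (multiple-<⇒≡0 (ℤ.∣⇒∣ᵤ p∣) small))))
    where
    small : ℤ.∣ toℤ x - toℤ y ∣ ℕ.< p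
    small = subst (ℕ._< p) (cong ℤ.∣_∣ (sym (ℤ.m-n≡m⊖n (toℕ x) (toℕ y))))
      (ℕ.≤-<-trans (ℤ.∣m⊝n∣≤m⊔n (toℕ x) (toℕ y))
        (ℕ.⊔-pres-<m (Fin.toℕ<n x) (Fin.toℕ<n y)))
    multiple-<⇒≡0 : ∀ {n} → p ℕ.∣ n → n ℕ.< p → n ≡ 0
    multiple-<⇒≡0 {zero} _ _ = refl
    multiple-<⇒≡0 {suc n} d l = contradiction (ℕ.∣⇒≤ d) (ℕ.<⇒≱ l)

  ∣⇒⟦⟧≡ : ∀ {a b} → + p ∣ a - b → ⟦ a ⟧ ≡ ⟦ b ⟧
  ∣⇒⟦⟧≡ {a} {b} (divides k eq) = ∣⇒toℕ≡ (divides (k - a /ℕ p + b /ℕ p) (begin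
    toℤ ⟦ a ⟧ - toℤ ⟦ b ⟧
      ≡⟨ lem (toℤ ⟦ a ⟧) (toℤ ⟦ b ⟧) (a /ℕ p) (b /ℕ p) (+ p) ⟩
    ((toℤ ⟦ a ⟧ + (a /ℕ p) * + p) - (toℤ ⟦ b ⟧ + (b /ℕ p) * + p)) - (a /ℕ p) * + p + (b /ℕ p) * + p
      ≡⟨ cong (λ d → d - (a /ℕ p) * + p + (b /ℕ p) * + p)
           (cong₂ _-_ (sym (⟦⟧-residue a)) (sym (⟦⟧-residue b))) ⟩
    (a - b) - (a /ℕ p) * + p + (b /ℕ p) * + p
      ≡⟨ cong (λ d → d - (a /ℕ p) * + p + (b /ℕ p) * + p) eq ⟩
    k * + p - (a /ℕ p) * + p + (b /ℕ p) * + p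
      ≡⟨ lem₂ k (a /ℕ p) (b /ℕ p) (+ p) ⟩
    (k - a /ℕ p + b /ℕ p) * + p ∎))
    where
    open ≡-Reasoning
    lem : ∀ r s u v w → r - s ≡ ((r + u * w) - (s + v * w)) - u * w + v * w
    lem = solve-∀
    lem₂ : ∀ k u v w → k * w - u * w + v * w ≡ (k - u + v) * w
    lem₂ = solve-∀

  ⟦⟧-toℤ : ∀ x → ⟦ toℤ x ⟧ ≡ x
  ⟦⟧-toℤ x = Fin.toℕ-injective (trans (toℕ-⟦⟧ (toℤ x)) (ℕ.m<n⇒m%n≡m (Fin.toℕ<n x)))

  infixl 6 _⊞_ _⊟_
  infixl 7 _⊠_

  opaque
    _⊞_ _⊠_ : F → F → F
    x ⊞ y = ⟦ toℤ x + toℤ y ⟧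
    x ⊠ y = ⟦ toℤ x * toℤ y ⟧

    neg : F → F
    neg x = ⟦ - toℤ x ⟧

    ⟦⟧-+ : ∀ a b → ⟦ a + b ⟧ ≡ ⟦ a ⟧ ⊞ ⟦ b ⟧
    ⟦⟧-+ a b = ∣⇒⟦⟧≡ (divides (a /ℕ p + b /ℕ p) (begin
      a + b - (toℤ ⟦ a ⟧ + toℤ ⟦ b ⟧)
        ≡⟨ cong (_- (toℤ ⟦ a ⟧ + toℤ ⟦ b ⟧)) (cong₂ _+_ (⟦⟧-residue a) (⟦⟧-residue b)) ⟩
      (toℤ ⟦ a ⟧ + (a /ℕ p) * + p) + (toℤ ⟦ b ⟧ + (b /ℕ p) * + p) - (toℤ ⟦ a ⟧ + toℤ ⟦ b ⟧)
        ≡⟨ lem (toℤ ⟦ a ⟧) (toℤ ⟦ b ⟧) (a /ℕ p) (b /ℕ p) (+ p) ⟩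
      (a /ℕ p + b /ℕ p) * + p ∎))
      where
      open ≡-Reasoning
      lem : ∀ r s u v w → (r + u * w) + (s + v * w) - (r + s) ≡ (u + v) * w
      lem = solve-∀

    -- With r and s the residues of a and b, ab - rs = (a - r)b + r(b - s), and both summands are
    -- multiples of p.
    ⟦⟧-* : ∀ a b → ⟦ a * b ⟧ ≡ ⟦ a ⟧ ⊠ ⟦ b ⟧
    ⟦⟧-* a b = ∣⇒⟦⟧≡ (divides ((a /ℕ p) * b + toℤ ⟦ a ⟧ * (b /ℕ p)) (begin
      a * b - toℤ ⟦ a ⟧ * toℤ ⟦ b ⟧
        ≡⟨ cong (λ z → z * b - toℤ ⟦ a ⟧ * toℤ ⟦ b ⟧) (⟦⟧-residue a) ⟩
      (toℤ ⟦ a ⟧ + (a /ℕ p) * + p) * b - toℤ ⟦ a ⟧ * toℤ ⟦ b ⟧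
        ≡⟨ lem₁ (toℤ ⟦ a ⟧) (toℤ ⟦ b ⟧) (a /ℕ p) b (+ p) ⟩
      (a /ℕ p) * b * + p + toℤ ⟦ a ⟧ * (b - toℤ ⟦ b ⟧)
        ≡⟨ cong (λ z → (a /ℕ p) * b * + p + toℤ ⟦ a ⟧ * (z - toℤ ⟦ b ⟧)) (⟦⟧-residue b) ⟩
      (a /ℕ p) * b * + p + toℤ ⟦ a ⟧ * ((toℤ ⟦ b ⟧ + (b /ℕ p) * + p) - toℤ ⟦ b ⟧)
        ≡⟨ lem₂ (toℤ ⟦ a ⟧) (toℤ ⟦ b ⟧) (a /ℕ p) (b /ℕ p) b (+ p) ⟩
      ((a /ℕ p) * b + toℤ ⟦ a ⟧ * (b /ℕ p)) * + p ∎))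
      where
      open ≡-Reasoning
      lem₁ : ∀ r s u b w → (r + u * w) * b - r * s ≡ u * b * w + r * (b - s)
      lem₁ = solve-∀
      lem₂ : ∀ r s u v b w → u * b * w + r * ((s + v * w) - s) ≡ (u * b + r * v) * w
      lem₂ = solve-∀

    ⟦⟧-neg : ∀ a → ⟦ - a ⟧ ≡ neg ⟦ a ⟧
    ⟦⟧-neg a = ∣⇒⟦⟧≡ (divides (- (a /ℕ p)) (begin
      - a - (- toℤ ⟦ a ⟧)
        ≡⟨ cong (λ z → - z - (- toℤ ⟦ a ⟧)) (⟦⟧-residue a) ⟩
      - (toℤ ⟦ a ⟧ + (a /ℕ p) * + p) - (- toℤ ⟦ a ⟧)
        ≡⟨ lem (toℤ ⟦ a ⟧) (a /ℕ p) (+ p) ⟩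
      - (a /ℕ p) * + p ∎))
      where
      open ≡-Reasoning
      lem : ∀ r u w → - (r + u * w) - (- r) ≡ - u * w
      lem = solve-∀

  _⊟_ : F → F → F
  x ⊟ y = x ⊞ neg y

  0# 1# : F
  0# = ⟦ + 0 ⟧
  1# = ⟦ + 1 ⟧

  -- ⟦_⟧ is a surjective homomorphism, so every ring law is inherited from ℤ.
  private
    lift₁ : {f g : F → F} → (∀ a → f ⟦ a ⟧ ≡ g ⟦ a ⟧) → ∀ x → f x ≡ g x
    lift₁ {f} {g} h x = subst (λ x → f x ≡ g x) (⟦⟧-toℤ x) (h (toℤ x))

    lift₂ : {f g : F → F → F} → (∀ a b → f ⟦ a ⟧ ⟦ b ⟧ ≡ g ⟦ a ⟧ ⟦ b ⟧) → ∀ x y → f x y ≡ g x y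
    lift₂ {f} {g} h x y = lift₁ {λ x → f x y} {λ x → g x y}
      (λ a → lift₁ {f ⟦ a ⟧} {g ⟦ a ⟧} (h a) y) x

    lift₃ : {f g : F → F → F → F} → (∀ a b c → f ⟦ a ⟧ ⟦ b ⟧ ⟦ c ⟧ ≡ g ⟦ a ⟧ ⟦ b ⟧ ⟦ c ⟧) →
            ∀ x y z → f x y z ≡ g x y z
    lift₃ {f} {g} h x y z = lift₁ {λ x → f x y z} {λ x → g x y z}
      (λ a → lift₂ {f ⟦ a ⟧} {g ⟦ a ⟧} (h a) y z) x

    ++ˡ : ∀ a b c → ⟦ (a + b) + c ⟧ ≡ (⟦ a ⟧ ⊞ ⟦ b ⟧) ⊞ ⟦ c ⟧
    ++ˡ a b c = trans (⟦⟧-+ _ c) (cong (_⊞ ⟦ c ⟧) (⟦⟧-+ a b))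

    ++ʳ : ∀ a b c → ⟦ a + (b + c) ⟧ ≡ ⟦ a ⟧ ⊞ (⟦ b ⟧ ⊞ ⟦ c ⟧)
    ++ʳ a b c = trans (⟦⟧-+ a _) (cong (⟦ a ⟧ ⊞_) (⟦⟧-+ b c))

    **ˡ : ∀ a b c → ⟦ (a * b) * c ⟧ ≡ (⟦ a ⟧ ⊠ ⟦ b ⟧) ⊠ ⟦ c ⟧
    **ˡ a b c = trans (⟦⟧-* _ c) (cong (_⊠ ⟦ c ⟧) (⟦⟧-* a b))

    **ʳ : ∀ a b c → ⟦ a * (b * c) ⟧ ≡ ⟦ a ⟧ ⊠ (⟦ b ⟧ ⊠ ⟦ c ⟧)
    **ʳ a b c = trans (⟦⟧-* a _) (cong (⟦ a ⟧ ⊠_) (⟦⟧-* b c))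

  ⊞-assoc : ∀ x y z → (x ⊞ y) ⊞ z ≡ x ⊞ (y ⊞ z)
  ⊞-assoc = lift₃ λ a b c → trans (sym (++ˡ a b c)) (trans (cong ⟦_⟧ (ℤ.+-assoc a b c)) (++ʳ a b c))

  ⊞-comm : ∀ x y → x ⊞ y ≡ y ⊞ x
  ⊞-comm = lift₂ λ a b → trans (sym (⟦⟧-+ a b)) (trans (cong ⟦_⟧ (ℤ.+-comm a b)) (⟦⟧-+ b a))

  ⊞-identityˡ : ∀ x → 0# ⊞ x ≡ x
  ⊞-identityˡ = lift₁ λ a → trans (sym (⟦⟧-+ (+ 0) a)) (cong ⟦_⟧ (ℤ.+-identityˡ a))

  ⊞-inverseˡ : ∀ x → neg x ⊞ x ≡ 0#
  ⊞-inverseˡ = lift₁ λ a → trans (cong (_⊞ ⟦ a ⟧) (sym (⟦⟧-neg a)))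
    (trans (sym (⟦⟧-+ (- a) a)) (cong ⟦_⟧ (ℤ.+-inverseˡ a)))

  ⊠-assoc : ∀ x y z → (x ⊠ y) ⊠ z ≡ x ⊠ (y ⊠ z)
  ⊠-assoc = lift₃ λ a b c → trans (sym (**ˡ a b c)) (trans (cong ⟦_⟧ (ℤ.*-assoc a b c)) (**ʳ a b c))

  ⊠-comm : ∀ x y → x ⊠ y ≡ y ⊠ x
  ⊠-comm = lift₂ λ a b → trans (sym (⟦⟧-* a b)) (trans (cong ⟦_⟧ (ℤ.*-comm a b)) (⟦⟧-* b a))

  ⊠-identityˡ : ∀ x → 1# ⊠ x ≡ x
  ⊠-identityˡ = lift₁ λ a → trans (sym (⟦⟧-* (+ 1) a)) (cong ⟦_⟧ (ℤ.*-identityˡ a))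

  ⊠-distribˡ-⊞ : ∀ x y z → x ⊠ (y ⊞ z) ≡ x ⊠ y ⊞ x ⊠ z
  ⊠-distribˡ-⊞ = lift₃ λ a b c → begin
    ⟦ a ⟧ ⊠ (⟦ b ⟧ ⊞ ⟦ c ⟧)      ≡⟨ cong (⟦ a ⟧ ⊠_) (⟦⟧-+ b c) ⟨
    ⟦ a ⟧ ⊠ ⟦ b + c ⟧            ≡⟨ ⟦⟧-* a (b + c) ⟨
    ⟦ a * (b + c) ⟧              ≡⟨ cong ⟦_⟧ (ℤ.*-distribˡ-+ a b c) ⟩
    ⟦ a * b + a * c ⟧            ≡⟨ ⟦⟧-+ (a * b) (a * c) ⟩
    ⟦ a * b ⟧ ⊞ ⟦ a * c ⟧        ≡⟨ cong₂ _⊞_ (⟦⟧-* a b) (⟦⟧-* a c) ⟩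
    ⟦ a ⟧ ⊠ ⟦ b ⟧ ⊞ ⟦ a ⟧ ⊠ ⟦ c ⟧ ∎
    where open ≡-Reasoning

  commutativeRing : CommutativeRing _ _
  commutativeRing = record
    { Carrier = F ; _≈_ = _≡_ ; _+_ = _⊞_ ; _*_ = _⊠_ ; -_ = neg ; 0# = 0# ; 1# = 1#
    ; isCommutativeRing = record
      { isRing = record
        { +-isAbelianGroup = record
          { isGroup = record
            { isMonoid = record
              { isSemigroup = record
                { isMagma = record { isEquivalence = isEquivalence ; ∙-cong = cong₂ _⊞_ }
                ; assoc = ⊞-assoc }
              ; identity = ⊞-identityˡ , λ x → trans (⊞-comm x 0#) (⊞-identityˡ x) }
            ; inverse = ⊞-inverseˡ , λ x → trans (⊞-comm x (neg x)) (⊞-inverseˡ x)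
            ; ⁻¹-cong = cong neg }
          ; comm = ⊞-comm }
        ; *-cong = cong₂ _⊠_
        ; *-assoc = ⊠-assoc
        ; *-identity = ⊠-identityˡ , λ x → trans (⊠-comm x 1#) (⊠-identityˡ x)
        ; distrib = ⊠-distribˡ-⊞ , λ x y z → trans (⊠-comm (y ⊞ z) x)
            (trans (⊠-distribˡ-⊞ x y z) (cong₂ _⊞_ (⊠-comm x y) (⊠-comm x z))) }
      ; *-comm = ⊠-comm } }

  private
    almostCommutativeRing : AlmostCommutativeRing _ _
    almostCommutativeRing = fromCommutativeRing commutativeRing

    ⟦⟧-homomorphism : ℤ.+-*-rawRing -Raw-AlmostCommutative⟶ almostCommutativeRing
    ⟦⟧-homomorphism = record
      { ⟦_⟧ = ⟦_⟧ ; +-homo = ⟦⟧-+ ; *-homo = ⟦⟧-* ; -‿homo = ⟦⟧-neg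
      ; 0-homo = refl ; 1-homo = refl }

    -- Coefficients are compared as integers, not modulo p, so the solver's identities hold
    -- uniformly in p; `nothing` only means that equality is not decided here.
    coefficient≟ : (a b : ℤ) → Maybe (⟦ a ⟧ ≡ ⟦ b ⟧)
    coefficient≟ a b with a ℤ.≟ b
    ... | yes eq = just (cong ⟦_⟧ eq)
    ... | no  _  = nothing

  open Algebra.Solver.Ring ℤ.+-*-rawRing almostCommutativeRing ⟦⟧-homomorphism coefficient≟
    using (solve; _:=_; _:+_; _:*_; _:-_; :-_; con) public

-- Auxiliary facts on sums, the inverse search, the order of three numbers and residues modulo 3

sumℕ-head : ∀ n (f : ℕ → ℤ) → sumℕ (suc n) f ≡ f 0 + sumℕ n (f ∘ suc)
sumℕ-head zero    f = ℤ.+-comm (+ 0) (f 0)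
sumℕ-head (suc n) f = trans (cong (_+ f (suc n)) (sumℕ-head n f))
  (ℤ.+-assoc (f 0) (sumℕ n (f ∘ suc)) (f (suc n)))

-- With n steps left the search tries p - n, ..., p - 1 in ascending order. The bound `p ∸ n ≤ y`
-- says that the witness y is still ahead; a failed test at p - n rules out equality and raises the
-- bound, so the default 0 is never reached.
invSearch-inverse : ∀ p x n → n ℕ.< p → ∀ y → p ∸ n ≤ y → y ℕ.< p → modN p (x ℕ.* y) ≡ 1 →
                    modN p (x ℕ.* invSearch p x n) ≡ 1
invSearch-inverse p x zero    n<p y p≤y y<p eq = contradiction p≤y (ℕ.<⇒≱ y<p)
invSearch-inverse p x (suc n) n<p y p≤y y<p eq with modN p (x ℕ.* (p ∸ suc n)) ℕ.≟ 1
... | yes found = found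
... | no  other = invSearch-inverse p x n (ℕ.<-trans (ℕ.n<1+n n) n<p) y
      (subst (_≤ y) (sym (ℕ.+-∸-assoc 1 (ℕ.<⇒≤ n<p))) (ℕ.≤∧≢⇒< p≤y λ { refl → other eq })) y<p eq

-- No candidate passes, because 0 · y leaves remainder 0. The default value thus becomes the
-- convention 0⁻¹ = 0.
invSearch-0 : ∀ q n → invSearch (suc q) 0 n ≡ 0
invSearch-0 q zero    = refl
invSearch-0 q (suc n) = invSearch-0 q n

lt : ℕ → ℕ → ℤ
lt m n = if ⌊ m ℕ.<? n ⌋ then + 1 else + 0

lt-yes : ∀ {m n} → m ℕ.< n → lt m n ≡ + 1
lt-yes {m} {n} m<n with m ℕ.<? n
... | yes _  = refl
... | no m≮n = contradiction m<n m≮n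

lt-no : ∀ {m n} → ¬ m ℕ.< n → lt m n ≡ + 0
lt-no {m} {n} m≮n with m ℕ.<? n
... | yes m<n = contradiction m<n m≮n
... | no _    = refl

-- Exactly one of three distinct numbers lies below the other two. The summands are in cyclic order
-- so as to fit a three-element orbit of `mobius`.
unique-minimum : ∀ {a b c} → a ≢ b → b ≢ c → c ≢ a →
                 lt a b * lt a c + lt b c * lt b a + lt c a * lt c b ≡ + 1
unique-minimum {a} {b} {c} a≢b b≢c c≢a = by-cases (ℕ.<-cmp a b) (ℕ.<-cmp b c) (ℕ.<-cmp c a)
  where
  value : ∀ {u v w x y z u′ v′ w′ x′ y′ z′ : ℤ} →
          u ≡ u′ → v ≡ v′ → w ≡ w′ → x ≡ x′ → y ≡ y′ → z ≡ z′ →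
          u * v + w * x + y * z ≡ u′ * v′ + w′ * x′ + y′ * z′
  value refl refl refl refl refl refl = refl
  by-cases : Tri (a ℕ.< b) (a ≡ b) (b ℕ.< a) → Tri (b ℕ.< c) (b ≡ c) (c ℕ.< b) →
             Tri (c ℕ.< a) (c ≡ a) (a ℕ.< c) →
             lt a b * lt a c + lt b c * lt b a + lt c a * lt c b ≡ + 1
  by-cases (tri≈ _ a≡b _) _ _ = contradiction a≡b a≢b
  by-cases _ (tri≈ _ b≡c _) _ = contradiction b≡c b≢c
  by-cases _ _ (tri≈ _ c≡a _) = contradiction c≡a c≢a
  by-cases (tri< a<b _ _) (tri< b<c _ _) (tri< c<a _ _) =
    contradiction (ℕ.<-trans a<b (ℕ.<-trans b<c c<a)) (ℕ.<-irrefl refl)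
  by-cases (tri> _ _ b<a) (tri> _ _ c<b) (tri> _ _ a<c) =
    contradiction (ℕ.<-trans b<a (ℕ.<-trans a<c c<b)) (ℕ.<-irrefl refl)
  by-cases (tri< a<b _ b≮a) (tri< b<c _ c≮b) (tri> c≮a _ a<c) =
    value (lt-yes a<b) (lt-yes a<c) (lt-yes b<c) (lt-no b≮a) (lt-no c≮a) (lt-no c≮b)
  by-cases (tri< a<b _ b≮a) (tri> b≮c _ c<b) (tri< c<a _ a≮c) =
    value (lt-yes a<b) (lt-no a≮c) (lt-no b≮c) (lt-no b≮a) (lt-yes c<a) (lt-yes c<b)
  by-cases (tri< a<b _ b≮a) (tri> b≮c _ c<b) (tri> c≮a _ a<c) =
    value (lt-yes a<b) (lt-yes a<c) (lt-no b≮c) (lt-no b≮a) (lt-no c≮a) (lt-yes c<b)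
  by-cases (tri> a≮b _ b<a) (tri< b<c _ c≮b) (tri< c<a _ a≮c) =
    value (lt-no a≮b) (lt-no a≮c) (lt-yes b<c) (lt-yes b<a) (lt-yes c<a) (lt-no c≮b)
  by-cases (tri> a≮b _ b<a) (tri< b<c _ c≮b) (tri> c≮a _ a<c) =
    value (lt-no a≮b) (lt-yes a<c) (lt-yes b<c) (lt-yes b<a) (lt-no c≮a) (lt-no c≮b)
  by-cases (tri> a≮b _ b<a) (tri> b≮c _ c<b) (tri< c<a _ a≮c) =
    value (lt-no a≮b) (lt-no a≮c) (lt-no b≮c) (lt-yes b<a) (lt-yes c<a) (lt-yes c<b)

legendre3-1 : ∀ n → n ℕ.% 3 ≡ 1 → legendre3 n ≡ + 1
legendre3-1 n eq rewrite eq = refl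

legendre3-2 : ∀ n → n ℕ.% 3 ≡ 2 → legendre3 n ≡ - + 1
legendre3-2 n eq rewrite eq = refl

-- The comparison takes place in the residue ring for p = 3, so the quotient k may be any integer.
residue3 : ∀ n r → r ℕ.< 3 → ∀ k → + n ≡ + r + k * + 3 → n ℕ.% 3 ≡ r
residue3 n r r<3 k eq = trans (sym (⟦⟧-nat n))
    (trans (cong toℕ (∣⇒⟦⟧≡ {+ n} {+ r} (ℤ.divides k (trans (cong (_- + r) eq) (lem (+ r) (k * + 3))))))
    (trans (⟦⟧-nat r) (ℕ.m<n⇒m%n≡m r<3)))
  where
  open Residues 2
  lem : ∀ r d → (r + d) - r ≡ d
  lem = solve-∀
  ⟦⟧-nat : ∀ n → toℕ ⟦ + n ⟧ ≡ n ℕ.% 3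
  ⟦⟧-nat n = toℕ-⟦⟧ (+ n)

sumFromTo-1 : ∀ q f → sumFromTo 1 q f ≡ sumℕ (suc q) f - f 0
sumFromTo-1 q f = trans (lem (f 0) (sumFromTo 1 q f)) (cong (_- f 0) (sym (sumℕ-head q f)))
  where
  lem : ∀ a b → b ≡ a + b - a
  lem = solve-∀

sumFromTo-2 : ∀ q f → 1 ≤ q → sumFromTo 2 q f ≡ sumℕ (suc q) f - f 0 - f 1
sumFromTo-2 (suc q) f _ = trans (lem (f 0) (f 1) (sumFromTo 2 (suc q) f))
  (cong (λ s → s - f 0 - f 1) (sym (trans (sumℕ-head (suc q) f) (cong (_+_ (f 0)) (sumℕ-head q (f ∘ suc))))))
  where
  lem : ∀ a b c → c ≡ a + (b + c) - a - b
  lem = solve-∀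

if-yes : ∀ {m n} {a b : ℤ} → m ≡ n → (if m == n then a else b) ≡ a
if-yes {m} {n} eq with m ℕ.≟ n
... | yes _  = refl
... | no neq = contradiction eq neq

if-no : ∀ {m n} {a b : ℤ} → m ≢ n → (if m == n then a else b) ≡ b
if-no {m} {n} neq with m ℕ.≟ n
... | yes eq = contradiction eq neq
... | no _   = refl

module Kloosterman (q : ℕ) (p-prime : Prime (suc q)) (5≤p : 5 ≤ suc q) where

  open Residues q

  -- Sums over the field

  opaque
    ∑ : (F → ℤ) → ℤ
    ∑ f = S.sum f

    ∑-cong : ∀ {f g} → (∀ x → f x ≡ g x) → ∑ f ≡ ∑ g
    ∑-cong = S.sum-cong-≗

    ∑-+ : ∀ (f g : F → ℤ) → ∑ (λ x → f x + g x) ≡ ∑ f + ∑ g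
    ∑-+ = S.∑-distrib-+

    ∑-swap : ∀ (f : F → F → ℤ) → ∑ (λ x → ∑ (f x)) ≡ ∑ (λ y → ∑ (λ x → f x y))
    ∑-swap = S.∑-comm

    ∑-*ˡ : ∀ c (f : F → ℤ) → ∑ (λ x → c * f x) ≡ c * ∑ f
    ∑-*ˡ c f = sym (S.*-distribˡ-sum c f)

    ∑-reindex : ∀ (σ τ : F → F) → (∀ x → σ (τ x) ≡ x) → (∀ x → τ (σ x) ≡ x) →
                ∀ f → ∑ (λ x → f (σ x)) ≡ ∑ f
    ∑-reindex σ τ στ τσ f = sym (S.sum-permute f (permutation σ τ στ τσ))

    ∑-remove : ∀ a f → (∀ x → x ≢ a → f x ≡ + 0) → ∑ f ≡ f a
    ∑-remove a f vanish = begin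
      S.sum f                          ≡⟨ S.sum-remove {i = a} f ⟩
      f a + S.sum (f ∘ punchIn a)      ≡⟨ cong (_+_ (f a)) (S.sum-cong-≗ λ j → vanish _ (Fin.punchInᵢ≢i a j)) ⟩
      f a + S.sum {q} (λ _ → + 0)      ≡⟨ cong (_+_ (f a)) (S.sum-replicate-zero q) ⟩
      f a + + 0                        ≡⟨ ℤ.+-identityʳ (f a) ⟩
      f a                              ∎
      where open ≡-Reasoning

    ∑-sumℕ : ∀ (f : ℕ → ℤ) → sumℕ p f ≡ ∑ (f ∘ toℕ)
    ∑-sumℕ = go p
      where
      go : ∀ n (f : ℕ → ℤ) → sumℕ n f ≡ S.sum {n} (f ∘ toℕ)
      go zero    f = refl
      go (suc n) f = trans (sumℕ-head n f) (cong (_+_ (f 0)) (go n (f ∘ suc)))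

    ∑-1 : ∑ (λ _ → + 1) ≡ + p
    ∑-1 = go p
      where
      go : ∀ n → S.sum {n} (λ _ → + 1) ≡ + n
      go zero    = refl
      go (suc n) = cong (_+_ (+ 1)) (go n)

  ∑-const : ∀ c → ∑ (λ _ → c) ≡ c * + p
  ∑-const c = trans (∑-cong λ _ → sym (ℤ.*-identityʳ c)) (trans (∑-*ˡ c (λ _ → + 1)) (cong (c *_) ∑-1))

  ∑-*ʳ : ∀ (f : F → ℤ) c → ∑ (λ x → f x * c) ≡ ∑ f * c
  ∑-*ʳ f c = trans (∑-cong λ x → ℤ.*-comm (f x) c) (trans (∑-*ˡ c f) (ℤ.*-comm c (∑ f)))

  ∑-- : ∀ (f g : F → ℤ) → ∑ (λ x → f x - g x) ≡ ∑ f - ∑ g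
  ∑-- f g = begin
    ∑ (λ x → f x - g x)               ≡⟨ ∑-+ f (λ x → - g x) ⟩
    ∑ f + ∑ (λ x → - g x)             ≡⟨ cong (_+_ (∑ f)) (∑-cong λ x → sym (ℤ.-1*i≡-i (g x))) ⟩
    ∑ f + ∑ (λ x → ℤ.-1ℤ * g x)       ≡⟨ cong (_+_ (∑ f)) (trans (∑-*ˡ ℤ.-1ℤ g) (ℤ.-1*i≡-i (∑ g))) ⟩
    ∑ f - ∑ g                         ∎
    where open ≡-Reasoning

  -- Indicator functions

  δ : F → F → ℤ
  δ x y = if ⌊ x ≟ y ⌋ then + 1 else + 0

  δ-yes : ∀ {x y} → x ≡ y → δ x y ≡ + 1
  δ-yes {x} {y} eq with x ≟ y
  ... | yes _  = refl
  ... | no neq = contradiction eq neq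

  δ-no : ∀ {x y} → x ≢ y → δ x y ≡ + 0
  δ-no {x} {y} neq with x ≟ y
  ... | yes eq = contradiction eq neq
  ... | no _   = refl

  δ-⇔ : ∀ {x y z w} → (x ≡ y → z ≡ w) → (z ≡ w → x ≡ y) → δ x y ≡ δ z w
  δ-⇔ {x} {y} to from with x ≟ y
  ... | yes eq = sym (δ-yes (to eq))
  ... | no neq = sym (δ-no (neq ∘ from))

  δ-sym : ∀ x y → δ x y ≡ δ y x
  δ-sym x y = δ-⇔ sym sym

  ∑-δ : ∀ a (f : F → ℤ) → ∑ (λ x → δ x a * f x) ≡ f a
  ∑-δ a f = trans (∑-remove a (λ x → δ x a * f x) λ x x≢a → cong (λ d → d * f x) (δ-no x≢a))
    (trans (cong (λ d → d * f a) (δ-yes {a} refl)) (ℤ.*-identityˡ (f a)))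

  ∑-δ1 : ∀ a → ∑ (λ x → δ x a) ≡ + 1
  ∑-δ1 a = trans (∑-cong λ x → sym (ℤ.*-identityʳ (δ x a))) (∑-δ a (λ _ → + 1))

  -- The indicator of x ≠ 0, in the form that makes a restricted sum the full sum minus one value
  -- (`∑-ν`).
  ν : F → ℤ
  ν x = + 1 - δ x 0#

  ν-0 : ∀ {x} → x ≡ 0# → ν x ≡ + 0
  ν-0 eq = cong (λ d → + 1 - d) (δ-yes eq)

  ν-1 : ∀ {x} → x ≢ 0# → ν x ≡ + 1
  ν-1 neq = cong (λ d → + 1 - d) (δ-no neq)

  ν-*-cong : ∀ x {a b} → (x ≢ 0# → a ≡ b) → ν x * a ≡ ν x * b
  ν-*-cong x {a} {b} h with x ≟ 0#
  ... | yes _  = refl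
  ... | no neq = cong (λ a → + 1 * a) (h neq)

  ν-⇔ : ∀ {x y} → (x ≡ 0# → y ≡ 0#) → (y ≡ 0# → x ≡ 0#) → ν x ≡ ν y
  ν-⇔ to from = cong (λ d → + 1 - d) (δ-⇔ to from)

  ν-* : ∀ x a → ν x * a ≡ a - δ x 0# * a
  ν-* x a = lem (δ x 0#) a
    where
    lem : ∀ d a → (+ 1 - d) * a ≡ a - d * a
    lem = solve-∀

  ∑-ν : ∀ (f : F → ℤ) → ∑ (λ x → ν x * f x) ≡ ∑ f - f 0#
  ∑-ν f = trans (∑-cong λ x → ν-* x (f x))
      (trans (∑-- f (λ x → δ x 0# * f x)) (cong (λ d → ∑ f - d) (∑-δ 0# f)))

  ∑-ν1 : ∑ ν ≡ + q
  ∑-ν1 = begin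
    ∑ ν                        ≡⟨ ∑-cong (λ x → sym (ℤ.*-identityʳ (ν x))) ⟩
    ∑ (λ x → ν x * + 1)        ≡⟨ ∑-ν (λ _ → + 1) ⟩
    ∑ (λ _ → + 1) - + 1        ≡⟨ cong (_- + 1) ∑-1 ⟩
    + p - + 1                  ≡⟨⟩
    + q                        ∎
    where open ≡-Reasoning

  -- Inverses

  -- Supplies 1, 2, 3, 4 ≠ 0. That is enough: completing squares needs 2 and 4, while 9 = 3 · 3 and
  -- 9 - 1 = 2 · 4 separate 9 from 0 and 1.
  <5⇒≢0# : ∀ n → suc n ℕ.< 5 → ⟦ + suc n ⟧ ≢ 0#
  <5⇒≢0# n n<5 eq = ℕ.<⇒≱ (ℕ.≤-trans n<5 5≤p)
    (ℕ.∣⇒≤ (subst (p ℕ.∣_) (cong ℤ.∣_∣ (ℤ.+-identityʳ (+ suc n))) (ℤ.∣⇒∣ᵤ (⟦⟧≡⇒∣ eq))))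

  1≢0 : 1# ≢ 0#
  1≢0 = <5⇒≢0# 0 (s≤s (s≤s z≤n))

  ⟦⟧-+-toℕ : ∀ n → toℕ ⟦ + n ⟧ ≡ n ℕ.% p
  ⟦⟧-+-toℕ n = toℕ-⟦⟧ (+ n)

  toℕ-0# : toℕ 0# ≡ 0
  toℕ-0# = ⟦⟧-+-toℕ 0

  toℕ-1# : toℕ 1# ≡ 1
  toℕ-1# = trans (⟦⟧-+-toℕ 1) (ℕ.m<n⇒m%n≡m (ℕ.≤-trans (s≤s (s≤s z≤n)) 5≤p))

  toℕ-⊠ : ∀ x y → toℕ (x ⊠ y) ≡ (toℕ x ℕ.* toℕ y) ℕ.% p
  toℕ-⊠ x y = begin
    toℕ (x ⊠ y)                        ≡⟨ cong₂ (λ x y → toℕ (x ⊠ y)) (⟦⟧-toℤ x) (⟦⟧-toℤ y) ⟨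
    toℕ (⟦ toℤ x ⟧ ⊠ ⟦ toℤ y ⟧)        ≡⟨ cong toℕ (⟦⟧-* (toℤ x) (toℤ y)) ⟨
    toℕ ⟦ toℤ x * toℤ y ⟧              ≡⟨ cong (λ z → toℕ ⟦ z ⟧) (ℤ.pos-* (toℕ x) (toℕ y)) ⟨
    toℕ ⟦ + (toℕ x ℕ.* toℕ y) ⟧        ≡⟨ ⟦⟧-+-toℕ (toℕ x ℕ.* toℕ y) ⟩
    (toℕ x ℕ.* toℕ y) ℕ.% p            ∎
    where open ≡-Reasoning

  -- Bézout's identity for p and x. Over the natural numbers it comes with two sign patterns: 1 + bx
  -- = ap gives the inverse -b, and 1 + ap = bx gives b.
  inverse-exists : ∀ {x} → x ≢ 0# → ∃ λ y → x ⊠ y ≡ 1#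
  inverse-exists {x} x≢0 with coprime-Bézout (prime⇒coprime p-prime {{ℕ.≢-nonZero toℕ≢0}} (Fin.toℕ<n x))
    where
    toℕ≢0 : toℕ x ≢ 0
    toℕ≢0 eq = x≢0 (Fin.toℕ-injective (trans eq (sym toℕ-0#)))
  ... | Bézout.+- a b eq = ⟦ - + b ⟧ , (begin
    x ⊠ ⟦ - + b ⟧               ≡⟨ cong (_⊠ ⟦ - + b ⟧) (⟦⟧-toℤ x) ⟨
    ⟦ toℤ x ⟧ ⊠ ⟦ - + b ⟧       ≡⟨ ⟦⟧-* (toℤ x) (- + b) ⟨
    ⟦ toℤ x * - + b ⟧           ≡⟨ ∣⇒⟦⟧≡
        (divides (- + a) (trans (lem (toℤ x) (+ b)) (trans (cong -_ eq′) (ℤ.neg-distribˡ-* (+ a) (+ p))))) ⟩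
    1#                          ∎)
    where
    open ≡-Reasoning
    eq′ : + 1 + + b * toℤ x ≡ + a * + p
    eq′ = trans (cong (_+_ (+ 1)) (sym (ℤ.pos-* b (toℕ x)))) (trans (cong +_ eq) (ℤ.pos-* a p))
    lem : ∀ x b → x * - b - + 1 ≡ - (+ 1 + b * x)
    lem = solve-∀
  ... | Bézout.-+ a b eq = ⟦ + b ⟧ , (begin
    x ⊠ ⟦ + b ⟧                 ≡⟨ cong (_⊠ ⟦ + b ⟧) (⟦⟧-toℤ x) ⟨
    ⟦ toℤ x ⟧ ⊠ ⟦ + b ⟧         ≡⟨ ⟦⟧-* (toℤ x) (+ b) ⟨
    ⟦ toℤ x * + b ⟧             ≡⟨ ∣⇒⟦⟧≡
        (divides (+ a) (trans (cong (_- + 1) (trans (ℤ.*-comm (toℤ x) (+ b)) (sym eq′))) (lem (+ a * + p)))) ⟩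
    1#                          ∎)
    where
    open ≡-Reasoning
    eq′ : + 1 + + a * + p ≡ + b * toℤ x
    eq′ = trans (cong (_+_ (+ 1)) (sym (ℤ.pos-* a p))) (trans (cong +_ eq) (ℤ.pos-* b (toℕ x)))
    lem : ∀ a → (+ 1 + a) - + 1 ≡ a
    lem = solve-∀

  infix 8 _⁻¹

  opaque
    -- Built from the search in the definition of `K`, so that Kloosterman sums translate directly.
    _⁻¹ : F → F
    x ⁻¹ = ⟦ + inv p (toℕ x) ⟧

    ⁻¹-def : ∀ x → x ⁻¹ ≡ ⟦ + inv p (toℕ x) ⟧
    ⁻¹-def x = refl

    ⁻¹-0 : 0# ⁻¹ ≡ 0#
    ⁻¹-0 = cong (λ n → ⟦ + n ⟧) (trans (cong (inv p) toℕ-0#) (invSearch-0 q q))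

    ⁻¹-inverseʳ : ∀ {x} → x ≢ 0# → x ⊠ x ⁻¹ ≡ 1#
    ⁻¹-inverseʳ {x} x≢0 with inverse-exists x≢0
    ... | y , xy≡1 = Fin.toℕ-injective (begin
      toℕ (x ⊠ ⟦ + inv p (toℕ x) ⟧)          ≡⟨ cong (λ x → toℕ (x ⊠ ⟦ + inv p (toℕ x) ⟧)) (⟦⟧-toℤ x) ⟨
      toℕ (⟦ toℤ x ⟧ ⊠ ⟦ + inv p (toℕ ⟦ toℤ x ⟧) ⟧)
        ≡⟨ cong (λ z → toℕ (⟦ toℤ x ⟧ ⊠ ⟦ + inv p (toℕ z) ⟧)) (⟦⟧-toℤ x) ⟩
      toℕ (⟦ toℤ x ⟧ ⊠ ⟦ + inv p (toℕ x) ⟧)  ≡⟨ cong toℕ (⟦⟧-* (toℤ x) (+ inv p (toℕ x))) ⟨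
      toℕ ⟦ toℤ x * + inv p (toℕ x) ⟧        ≡⟨ cong (λ z → toℕ ⟦ z ⟧) (ℤ.pos-* (toℕ x) _) ⟨
      toℕ ⟦ + (toℕ x ℕ.* inv p (toℕ x)) ⟧    ≡⟨ ⟦⟧-+-toℕ _ ⟩
      (toℕ x ℕ.* inv p (toℕ x)) ℕ.% p
        ≡⟨ invSearch-inverse p (toℕ x) q (ℕ.n<1+n q) (toℕ y) 1≤y (Fin.toℕ<n y)
             (trans (sym (toℕ-⊠ x y)) (trans (cong toℕ xy≡1) toℕ-1#)) ⟩
      1                                      ≡⟨ toℕ-1# ⟨
      toℕ 1#                                 ∎)
      where
      open ≡-Reasoning
      y≢0 : toℕ y ≢ 0
      y≢0 eq = 1≢0 (trans (sym xy≡1) (Fin.toℕ-injective (trans (toℕ-⊠ x y)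
        (trans (cong (ℕ._% p) (trans (cong (toℕ x ℕ.*_) eq) (ℕ.*-zeroʳ (toℕ x)))) (sym toℕ-0#)))))
      1≤y : p ∸ q ≤ toℕ y
      1≤y = subst (_≤ toℕ y) (sym (ℕ.m+n∸n≡m 1 q)) (ℕ.n≢0⇒n>0 y≢0)

  ⊠-zeroˡ : ∀ x → 0# ⊠ x ≡ 0#
  ⊠-zeroˡ = solve 1 (λ x → con (+ 0) :* x := con (+ 0)) refl

  ⊠-zeroʳ : ∀ x → x ⊠ 0# ≡ 0#
  ⊠-zeroʳ = solve 1 (λ x → x :* con (+ 0) := con (+ 0)) refl

  ⊠-identityʳ : ∀ x → x ⊠ 1# ≡ x
  ⊠-identityʳ = solve 1 (λ x → x :* con (+ 1) := x) refl

  ⁻¹-cancelˡ : ∀ {x} → x ≢ 0# → ∀ y → x ⁻¹ ⊠ (x ⊠ y) ≡ y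
  ⁻¹-cancelˡ {x} x≢0 y = begin
    x ⁻¹ ⊠ (x ⊠ y)    ≡⟨ solve 3 (λ x i y → i :* (x :* y) := (x :* i) :* y) refl x (x ⁻¹) y ⟩
    (x ⊠ x ⁻¹) ⊠ y    ≡⟨ cong (_⊠ y) (⁻¹-inverseʳ x≢0) ⟩
    1# ⊠ y            ≡⟨ ⊠-identityˡ y ⟩
    y                 ∎
    where open ≡-Reasoning

  ⁻¹-cancelʳ : ∀ {x} → x ≢ 0# → ∀ y → x ⊠ (x ⁻¹ ⊠ y) ≡ y
  ⁻¹-cancelʳ {x} x≢0 y = begin
    x ⊠ (x ⁻¹ ⊠ y)    ≡⟨ ⊠-assoc x (x ⁻¹) y ⟨
    (x ⊠ x ⁻¹) ⊠ y    ≡⟨ cong (_⊠ y) (⁻¹-inverseʳ x≢0) ⟩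
    1# ⊠ y            ≡⟨ ⊠-identityˡ y ⟩
    y                 ∎
    where open ≡-Reasoning

  ⊠-cancelˡ : ∀ {x} → x ≢ 0# → ∀ {y z} → x ⊠ y ≡ x ⊠ z → y ≡ z
  ⊠-cancelˡ {x} x≢0 {y} {z} eq = trans (sym (⁻¹-cancelˡ x≢0 y))
    (trans (cong (x ⁻¹ ⊠_) eq) (⁻¹-cancelˡ x≢0 z))

  ⊠-≡0 : ∀ {x y} → x ⊠ y ≡ 0# → x ≡ 0# ⊎ y ≡ 0#
  ⊠-≡0 {x} {y} eq with x ≟ 0#
  ... | yes x≡0 = inj₁ x≡0
  ... | no  x≢0 = inj₂ (⊠-cancelˡ x≢0 (trans eq (sym (⊠-zeroʳ x))))

  ⊠-≢0 : ∀ {x y} → x ≢ 0# → y ≢ 0# → x ⊠ y ≢ 0#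
  ⊠-≢0 x≢0 y≢0 eq with ⊠-≡0 eq
  ... | inj₁ x≡0 = x≢0 x≡0
  ... | inj₂ y≡0 = y≢0 y≡0

  ⊠-factorˡ-≢0 : ∀ {x y} → x ⊠ y ≡ 1# → x ≢ 0#
  ⊠-factorˡ-≢0 {x} {y} eq x≡0 = 1≢0 (trans (sym eq) (trans (cong (_⊠ y) x≡0) (⊠-zeroˡ y)))

  ⁻¹-unique : ∀ {x y} → x ⊠ y ≡ 1# → y ≡ x ⁻¹
  ⁻¹-unique {x} {y} eq = ⊠-cancelˡ (⊠-factorˡ-≢0 eq) (trans eq (sym (⁻¹-inverseʳ (⊠-factorˡ-≢0 eq))))

  ⁻¹-≢0 : ∀ {x} → x ≢ 0# → x ⁻¹ ≢ 0#
  ⁻¹-≢0 {x} x≢0 = ⊠-factorˡ-≢0 (trans (⊠-comm (x ⁻¹) x) (⁻¹-inverseʳ x≢0))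

  ⁻¹-involutive : ∀ x → (x ⁻¹) ⁻¹ ≡ x
  ⁻¹-involutive x with x ≟ 0#
  ... | yes refl = trans (cong _⁻¹ ⁻¹-0) ⁻¹-0
  ... | no  x≢0  = sym (⁻¹-unique (trans (⊠-comm (x ⁻¹) x) (⁻¹-inverseʳ x≢0)))

  ⁻¹-⊠ : ∀ x y → (x ⊠ y) ⁻¹ ≡ x ⁻¹ ⊠ y ⁻¹
  ⁻¹-⊠ x y with x ≟ 0# | y ≟ 0#
  ... | yes refl | _ = trans (cong _⁻¹ (⊠-zeroˡ y))
      (trans ⁻¹-0 (sym (trans (cong (_⊠ y ⁻¹) ⁻¹-0) (⊠-zeroˡ (y ⁻¹)))))
  ... | no _ | yes refl = trans (cong _⁻¹ (⊠-zeroʳ x))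
      (trans ⁻¹-0 (sym (trans (cong (x ⁻¹ ⊠_) ⁻¹-0) (⊠-zeroʳ (x ⁻¹)))))
  ... | no x≢0 | no y≢0 = sym (⁻¹-unique (begin
    x ⊠ y ⊠ (x ⁻¹ ⊠ y ⁻¹)       ≡⟨ solve 4 (λ x y i j → x :* y :* (i :* j) := (x :* i) :* (y :* j)) refl x y
        (x ⁻¹) (y ⁻¹) ⟩
    (x ⊠ x ⁻¹) ⊠ (y ⊠ y ⁻¹)     ≡⟨ cong₂ _⊠_ (⁻¹-inverseʳ x≢0) (⁻¹-inverseʳ y≢0) ⟩
    1# ⊠ 1#                     ≡⟨ ⊠-identityˡ 1# ⟩
    1#                          ∎))
    where open ≡-Reasoning

  ⊟≡0⇒≡ : ∀ {x y} → x ⊟ y ≡ 0# → x ≡ y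
  ⊟≡0⇒≡ {x} {y} eq = trans (solve 2 (λ x y → x := (x :- y) :+ y) refl x y)
    (trans (cong (_⊞ y) eq) (⊞-identityˡ y))

  ≡⇒⊟≡0 : ∀ {x y} → x ≡ y → x ⊟ y ≡ 0#
  ≡⇒⊟≡0 {x} refl = solve 1 (λ x → x :- x := con (+ 0)) refl x

  ∑-shift : ∀ a (f : F → ℤ) → ∑ (λ x → f (x ⊞ a)) ≡ ∑ f
  ∑-shift a = ∑-reindex (_⊞ a) (_⊟ a)
    (λ x → solve 2 (λ x a → x :- a :+ a := x) refl x a)
    (λ x → solve 2 (λ x a → x :+ a :- a := x) refl x a)

  ∑-scale : ∀ {c} → c ≢ 0# → ∀ (f : F → ℤ) → ∑ (λ x → f (c ⊠ x)) ≡ ∑ f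
  ∑-scale {c} c≢0 = ∑-reindex (c ⊠_) (c ⁻¹ ⊠_) (⁻¹-cancelʳ c≢0) (⁻¹-cancelˡ c≢0)

  ∑-⁻¹ : ∀ (f : F → ℤ) → ∑ (λ x → f (x ⁻¹)) ≡ ∑ f
  ∑-⁻¹ = ∑-reindex _⁻¹ _⁻¹ ⁻¹-involutive ⁻¹-involutive

  ∑-reflect : ∀ a (f : F → ℤ) → ∑ (λ x → f (a ⊟ x)) ≡ ∑ f
  ∑-reflect a = ∑-reindex (a ⊟_) (a ⊟_) invol invol
    where
    invol : ∀ x → a ⊟ (a ⊟ x) ≡ x
    invol = λ x → solve 2 (λ x a → a :- (a :- x) := x) refl x a

  -- Square roots and the value of (p/3)

  2≢0 : ⟦ + 2 ⟧ ≢ 0#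
  2≢0 = <5⇒≢0# 1 (s≤s (s≤s (s≤s z≤n)))

  3≢0 : ⟦ + 3 ⟧ ≢ 0#
  3≢0 = <5⇒≢0# 2 (s≤s (s≤s (s≤s (s≤s z≤n))))

  4≢0 : ⟦ + 4 ⟧ ≢ 0#
  4≢0 = <5⇒≢0# 3 (s≤s (s≤s (s≤s (s≤s (s≤s z≤n)))))

  neg-≢0 : ∀ {x} → x ≢ 0# → neg x ≢ 0#
  neg-≢0 {x} x≢0 eq = x≢0 (trans (solve 1 (λ x → x := :- (:- x)) refl x)
    (trans (cong neg eq) (solve 0 (:- con (+ 0) := con (+ 0)) refl)))

  x²≡0⇒x≡0 : ∀ {x} → x ⊠ x ≡ 0# → x ≡ 0#
  x²≡0⇒x≡0 eq = Sum.[ id , id ]′ (⊠-≡0 eq)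

  x²≡y²⇒x≡±y : ∀ {x y} → x ⊠ x ≡ y ⊠ y → x ≡ y ⊎ x ≡ neg y
  x²≡y²⇒x≡±y {x} {y} eq = Sum.map ⊟≡0⇒≡ ⊟≡0⇒≡ (⊠-≡0 {x ⊟ y} {x ⊟ neg y} (begin
    (x ⊟ y) ⊠ (x ⊟ neg y)   ≡⟨ solve 2 (λ x y → (x :- y) :* (x :- (:- y)) := x :* x :- y :* y) refl x y ⟩
    x ⊠ x ⊟ y ⊠ y           ≡⟨ ≡⇒⊟≡0 eq ⟩
    0#                      ∎))
    where open ≡-Reasoning

  -- This is 1 + (D/p), the quadratic character in counting form.
  roots : F → ℤ
  roots D = ∑ λ w → δ (w ⊠ w) D

  -- The substitution of cw for w. It lets discriminants and curve equations change by nonzero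
  -- square factors.
  roots-scale : ∀ c D → c ≢ 0# → roots (c ⊠ c ⊠ D) ≡ roots D
  roots-scale c D c≢0 = trans (sym (∑-scale c≢0 (λ w → δ (w ⊠ w) (c ⊠ c ⊠ D))))
    (∑-cong λ w → δ-⇔
      (λ eq → ⊠-cancelˡ (⊠-≢0 c≢0 c≢0) (trans (square w) eq))
      (λ eq → trans (sym (square w)) (cong (c ⊠ c ⊠_) eq)))
    where
    square : ∀ w → c ⊠ c ⊠ (w ⊠ w) ≡ c ⊠ w ⊠ (c ⊠ w)
    square w = solve 2 (λ c w → c :* c :* (w :* w) := c :* w :* (c :* w)) refl c w

  -- Every w is a square root of exactly one D. In terms of characters: the Legendre symbols sum to
  -- zero.
  ∑-roots : ∑ roots ≡ + p
  ∑-roots = trans (∑-swap (λ D w → δ (w ⊠ w) D))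
    (trans (∑-cong λ w → trans (∑-cong λ D → δ-sym (w ⊠ w) D) (∑-δ1 (w ⊠ w))) ∑-1)

  roots-0 : ∀ {D} → D ≡ 0# → roots D ≡ + 1
  roots-0 refl = trans (∑-cong λ w → δ-⇔ x²≡0⇒x≡0 (λ { refl → ⊠-zeroˡ 0# })) (∑-δ1 0#)

  roots-square : ∀ c {D} → D ≡ c ⊠ c → c ≢ 0# → roots D ≡ + 2
  roots-square c refl c≢0 = begin
    ∑ (λ w → δ (w ⊠ w) (c ⊠ c))               ≡⟨ ∑-cong pointwise ⟩
    ∑ (λ w → δ w c + δ w (neg c))             ≡⟨ ∑-+ (λ w → δ w c) (λ w → δ w (neg c)) ⟩
    ∑ (λ w → δ w c) + ∑ (λ w → δ w (neg c))   ≡⟨ cong₂ _+_ (∑-δ1 c) (∑-δ1 (neg c)) ⟩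
    + 2                                       ∎
    where
    open ≡-Reasoning
    c≢-c : c ≢ neg c
    c≢-c eq = ⊠-≢0 2≢0 c≢0 (trans (solve 1 (λ c → con (+ 2) :* c := c :- (:- c)) refl c) (≡⇒⊟≡0 eq))
    neg² : neg c ⊠ neg c ≡ c ⊠ c
    neg² = solve 1 (λ c → (:- c) :* (:- c) := c :* c) refl c
    pointwise : ∀ w → δ (w ⊠ w) (c ⊠ c) ≡ δ w c + δ w (neg c)
    pointwise w with w ≟ c | w ≟ neg c
    ... | yes refl | yes eq   = contradiction eq c≢-c
    ... | yes refl | no _     = δ-yes refl
    ... | no _     | yes refl = δ-yes neg²
    ... | no w≢c   | no w≢-c  = δ-no λ eq → Sum.[ w≢c , w≢-c ]′ (x²≡y²⇒x≡±y eq)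

  ∑-roots-affine : ∀ {a} b → a ≢ 0# → ∑ (λ t → roots (a ⊠ t ⊞ b)) ≡ + p
  ∑-roots-affine {a} b a≢0 = trans (∑-scale a≢0 (λ t → roots (t ⊞ b))) (trans (∑-shift b roots) ∑-roots)

  -- This is 1 + (-3/p), the source of the term (p/3) in the formula.
  ρ : ℤ
  ρ = roots ⟦ - + 3 ⟧

  -3≢0 : ⟦ - + 3 ⟧ ≢ 0#
  -3≢0 eq = neg-≢0 3≢0 (trans (sym (⟦⟧-neg (+ 3))) eq)

  ρ-values : ρ ≡ + 0 ⊎ ρ ≡ + 2
  ρ-values with Fin.any? (λ w → (w ⊠ w) ≟ ⟦ - + 3 ⟧)
  ... | yes (w , eq) = inj₂ (roots-square w (sym eq) λ { refl → -3≢0 (trans (sym eq) (⊠-zeroˡ 0#)) })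
  ... | no none = inj₁ (trans (∑-cong λ w → δ-no λ eq → none (w , eq)) (∑-const (+ 0)))

  -- Since ε² = 1, completing the square gives 4(x² + εx + 1) = (2x + ε)² + 3, so the discriminant
  -- is -3 for either sign.
  ρ-quadratic : ∀ ε → ε ⊠ ε ≡ 1# → ∑ (λ x → δ (x ⊠ x ⊞ ε ⊠ x ⊞ 1#) 0#) ≡ ρ
  ρ-quadratic ε ε²≡1 = trans (∑-cong pointwise)
    (trans (∑-scale 2≢0 (λ w → δ ((w ⊞ ε) ⊠ (w ⊞ ε)) ⟦ - + 3 ⟧)) (∑-shift ε (λ w → δ (w ⊠ w) ⟦ - + 3 ⟧)))
    where
    complete : ∀ x → ⟦ + 4 ⟧ ⊠ (x ⊠ x ⊞ ε ⊠ x ⊞ 1#) ≡ (⟦ + 2 ⟧ ⊠ x ⊞ ε) ⊠ (⟦ + 2 ⟧ ⊠ x ⊞ ε) ⊟ ⟦ - + 3 ⟧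
    complete x = trans (solve 2 (λ x ε → con (+ 4) :* (x :* x :+ ε :* x :+ con (+ 1))
        := (con (+ 2) :* x :+ ε) :* (con (+ 2) :* x :+ ε) :- ε :* ε :+ con (+ 4)) refl x ε)
      (trans (cong (λ e → (⟦ + 2 ⟧ ⊠ x ⊞ ε) ⊠ (⟦ + 2 ⟧ ⊠ x ⊞ ε) ⊟ e ⊞ ⟦ + 4 ⟧) ε²≡1)
        (solve 2 (λ x ε → (con (+ 2) :* x :+ ε) :* (con (+ 2) :* x :+ ε) :- con (+ 1) :+ con (+ 4)
          := (con (+ 2) :* x :+ ε) :* (con (+ 2) :* x :+ ε) :- con (- + 3)) refl x ε))
    pointwise : ∀ x → δ (x ⊠ x ⊞ ε ⊠ x ⊞ 1#) 0# ≡ δ ((⟦ + 2 ⟧ ⊠ x ⊞ ε) ⊠ (⟦ + 2 ⟧ ⊠ x ⊞ ε)) ⟦ - + 3 ⟧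
    pointwise x = δ-⇔
      (λ eq → ⊟≡0⇒≡ (trans (sym (complete x)) (trans (cong (⟦ + 4 ⟧ ⊠_) eq) (⊠-zeroʳ _))))
      (λ eq → ⊠-cancelˡ 4≢0 (trans (complete x) (trans (≡⇒⊟≡0 eq) (sym (⊠-zeroʳ _)))))

  -- With 0⁻¹ = 0 the Möbius map x ↦ 1/(1-x) is a bijection of F that swaps 0 and 1; elsewhere it has
  -- order 3 and its fixed points are the roots of x² - x + 1, so p - 2 ≡ ρ (mod 3).
  mobius : F → F
  mobius x = (1# ⊟ x) ⁻¹

  ∑-mobius : ∀ (f : F → ℤ) → ∑ (λ x → f (mobius x)) ≡ ∑ f
  ∑-mobius f = trans (∑-reflect 1# (λ x → f (x ⁻¹))) (∑-⁻¹ f)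

  private
    α : F → ℤ
    α x = ν x * ν (1# ⊟ x)

    α-yes : ∀ {x} → x ≢ 0# → 1# ⊟ x ≢ 0# → α x ≡ + 1
    α-yes h k rewrite ν-1 h | ν-1 k = refl

    α-no : ∀ {x} → x ≡ 0# ⊎ 1# ⊟ x ≡ 0# → α x ≡ + 0
    α-no {x} (inj₁ h) rewrite ν-0 h = refl
    α-no {x} (inj₂ h) = trans (cong (ν x *_) (ν-0 h)) (ℤ.*-zeroʳ (ν x))

    inside : F → Set
    inside x = x ≢ 0# × 1# ⊟ x ≢ 0#

    inside? : ∀ x → inside x ⊎ (x ≡ 0# ⊎ 1# ⊟ x ≡ 0#)
    inside? x with x ≟ 0# | (1# ⊟ x) ≟ 0#
    ... | yes h | _     = inj₂ (inj₁ h)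
    ... | no  _ | yes h = inj₂ (inj₂ h)
    ... | no  h | no  k = inj₁ (h , k)

    mobius-eq : ∀ {x} → 1# ⊟ x ≢ 0# → (1# ⊟ x) ⊠ mobius x ≡ 1#
    mobius-eq = ⁻¹-inverseʳ

    1-mobius : ∀ {x} → 1# ⊟ x ≢ 0# → 1# ⊟ mobius x ≡ neg x ⊠ mobius x
    1-mobius {x} h = trans (cong (_⊟ mobius x) (sym (mobius-eq h)))
      (solve 2 (λ x m → (con (+ 1) :- x) :* m :- m := (:- x) :* m) refl x (mobius x))

    mobius-inside : ∀ {x} → inside x → inside (mobius x)
    mobius-inside {x} (x≢0 , 1-x≢0) = ⁻¹-≢0 1-x≢0 ,
      λ eq → ⊠-≢0 (neg-≢0 x≢0) (⁻¹-≢0 1-x≢0) (trans (sym (1-mobius 1-x≢0)) eq)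

    -- Multiplied by -mn, both sides become 1: the left one by 1 - n = -mn, the right one by 1 - m =
    -- -xm.
    mobius³ : ∀ {x} → inside x → mobius (mobius (mobius x)) ≡ x
    mobius³ {x} i@(x≢0 , 1-x≢0) = ⊠-cancelˡ nz (begin
      neg m ⊠ n ⊠ mobius n       ≡⟨ cong (_⊠ mobius n) (sym (1-mobius (proj₂ (mobius-inside i)))) ⟩
      (1# ⊟ n) ⊠ mobius n        ≡⟨ mobius-eq (proj₂ (mobius-inside (mobius-inside i))) ⟩
      1#                         ≡⟨ mobius-eq (proj₂ (mobius-inside i)) ⟨
      (1# ⊟ m) ⊠ n               ≡⟨ cong (_⊠ n) (1-mobius 1-x≢0) ⟩
      neg x ⊠ m ⊠ n              ≡⟨ solve 3 (λ x m n → (:- x) :* m :* n := (:- m) :* n :* x) refl x m n ⟩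
      neg m ⊠ n ⊠ x              ∎)
      where
      open ≡-Reasoning
      m = mobius x
      n = mobius m
      nz : neg m ⊠ n ≢ 0#
      nz = ⊠-≢0 (neg-≢0 (proj₁ (mobius-inside i))) (proj₁ (mobius-inside (mobius-inside i)))

    mobius-0 : mobius 0# ≡ 1#
    mobius-0 = sym (⁻¹-unique (solve 0 ((con (+ 1) :- con (+ 0)) :* con (+ 1) := con (+ 1)) refl))

    α-mobius : ∀ x → α (mobius x) ≡ α x
    α-mobius x with inside? x
    ... | inj₁ i@(x≢0 , 1-x≢0) = trans (α-yes (proj₁ (mobius-inside i)) (proj₂ (mobius-inside i)))
        (sym (α-yes x≢0 1-x≢0))
    ... | inj₂ (inj₁ refl) = trans (α-no (inj₂ (trans (cong (1# ⊟_) mobius-0) (≡⇒⊟≡0 refl))))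
        (sym (α-no (inj₁ refl)))
    ... | inj₂ (inj₂ eq)   = trans (α-no (inj₁ (trans (cong _⁻¹ eq) ⁻¹-0))) (sym (α-no (inj₂ eq)))

    minimal : F → F → F → ℤ
    minimal x y z = lt (toℕ x) (toℕ y) * lt (toℕ x) (toℕ z)

    -- Selects the element with the smallest representative from an orbit of size three and vanishes
    -- at fixed points, so that orbits are counted without forming a quotient.
    orbit-min : F → ℤ
    orbit-min x = minimal x (mobius x) (mobius (mobius x))

    -- On an orbit of size three one of the three selections is 1 and the last δ is 0; at a fixed
    -- point it is the reverse. Summed over x, the three selections contribute equally.
    orbit-pointwise : ∀ x → α x * orbit-min x + α (mobius x) * orbit-min (mobius x)
        + α (mobius (mobius x)) * orbit-min (mobius (mobius x)) + α x * δ (mobius x) x ≡ α x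
    orbit-pointwise x = trans
      (cong₂ (λ a b → α x * orbit-min x + a * orbit-min (mobius x) + b * orbit-min (mobius (mobius x)) + α x * δ
          (mobius x) x)
        (α-mobius x) (trans (α-mobius (mobius x)) (α-mobius x)))
      (trans (collect (α x) (orbit-min x) (orbit-min (mobius x)) (orbit-min (mobius (mobius x)))
          (δ (mobius x) x)) main)
      where
      collect : ∀ a u v w d → a * u + a * v + a * w + a * d ≡ a * (u + v + w + d)
      collect = solve-∀
      main : α x * (orbit-min x + orbit-min (mobius x) + orbit-min (mobius (mobius x)) + δ (mobius x) x) ≡ α x
      main with inside? x
      ... | inj₂ o = trans (cong (λ a → a * (orbit-min x + orbit-min (mobius x) + orbit-min (mobius (mobius x))
          + δ (mobius x) x)) (α-no o)) (sym (α-no o))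
      ... | inj₁ i@(x≢0 , 1-x≢0) = trans (cong (α x *_) one) (ℤ.*-identityʳ (α x))
        where
        m n : F
        m = mobius x
        n = mobius m
        minima : F → F → F → ℤ
        minima x m n = minimal x m n + minimal m n x + minimal n x m
        minima-diagonal : ∀ {m n} → m ≡ x → n ≡ x → minima x m n ≡ + 0
        minima-diagonal refl refl = cong (λ l → l * l + l * l + l * l) (lt-no (ℕ.<-irrefl {toℕ x} refl))
        minima-fixed : Dec (m ≡ x) → minima x m n + δ m x ≡ + 1
        minima-fixed (yes eq) = cong₂ _+_ (minima-diagonal eq (trans (cong mobius eq) eq)) (δ-yes eq)
        -- By `mobius³`, a coincidence of any two elements of the orbit would already give m = x.
        minima-fixed (no neq) = cong₂ _+_ (unique-minimum
          (λ h → neq (sym (Fin.toℕ-injective h)))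
          (λ h → neq (trans (sym (mobius³ (mobius-inside i)))
            (trans (cong (mobius ∘ mobius) (sym (Fin.toℕ-injective h))) (mobius³ i))))
          (λ h → neq (trans (cong mobius (sym (Fin.toℕ-injective h))) (mobius³ i)))) (δ-no neq)
        one : orbit-min x + orbit-min m + orbit-min n + δ m x ≡ + 1
        one = trans (cong (λ y → minimal x m n + minimal m n y + minimal n y (mobius y) + δ m x) (mobius³ i))
          (minima-fixed (m ≟ x))

    ∑-α : ∑ α ≡ + p - + 2
    ∑-α = begin
      ∑ α                                   ≡⟨ ∑-ν (λ x → ν (1# ⊟ x)) ⟩
      ∑ (λ x → ν (1# ⊟ x)) - ν (1# ⊟ 0#)    ≡⟨ cong₂ _-_ (trans (∑-reflect 1# ν) ∑-ν1)
          (ν-1 λ eq → 1≢0 (⊟≡0⇒≡ eq)) ⟩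
      + q - + 1                             ≡⟨ lem (+ q) ⟩
      (+ 1 + + q) - + 2                     ∎
      where
      open ≡-Reasoning
      lem : ∀ q → q - + 1 ≡ (+ 1 + q) - + 2
      lem = solve-∀

    -- The weight `α` loses no roots: x² - x + 1 = 1 - (1 - x)x equals 1 at x = 0 and at x = 1.
    ∑-fixed : ∑ (λ x → α x * δ (mobius x) x) ≡ ρ
    ∑-fixed = trans (∑-cong pointwise)
        (ρ-quadratic ⟦ - + 1 ⟧ (solve 0 (con (- + 1) :* con (- + 1) := con (+ 1)) refl))
      where
      poly : F → F
      poly x = x ⊠ x ⊞ ⟦ - + 1 ⟧ ⊠ x ⊞ 1#
      at-0 : poly 0# ≡ 1#
      at-0 = solve 0 (con (+ 0) :* con (+ 0) :+ con (- + 1) :* con (+ 0) :+ con (+ 1) := con (+ 1)) refl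
      poly-eq : ∀ x → poly x ≡ 1# ⊟ (1# ⊟ x) ⊠ x
      poly-eq x = solve 1 (λ x → x :* x :+ con (- + 1) :* x :+ con (+ 1) := con (+ 1) :- (con (+ 1) :- x) :* x)
          refl x
      pointwise : ∀ x → α x * δ (mobius x) x ≡ δ (poly x) 0#
      pointwise x with inside? x
      ... | inj₁ (x≢0 , 1-x≢0) = trans (cong (_* δ (mobius x) x) (α-yes x≢0 1-x≢0))
          (trans (ℤ.*-identityˡ (δ (mobius x) x))
            (δ-⇔ (λ eq → trans (poly-eq x) (≡⇒⊟≡0 (trans (sym (mobius-eq 1-x≢0)) (cong ((1# ⊟ x) ⊠_) eq))))
                 (λ eq → sym (⁻¹-unique (sym (⊟≡0⇒≡ (trans (sym (poly-eq x)) eq)))))))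
      ... | inj₂ (inj₁ refl) = trans (cong (_* δ (mobius 0#) 0#) (α-no {0#} (inj₁ refl)))
          (sym (δ-no λ eq → 1≢0 (trans (sym at-0) eq)))
      ... | inj₂ (inj₂ eq)   = trans (cong (_* δ (mobius x) x) (α-no (inj₂ eq)))
            (sym (δ-no λ h → 1≢0 (trans (sym (trans (cong (λ z → 1# ⊟ z ⊠ x) eq)
              (solve 1 (λ x → con (+ 1) :- con (+ 0) :* x := con (+ 1)) refl x))) (trans (sym (poly-eq x)) h))))

  -- The witness T is the number of orbits of size three.
  p-2≡ρ-mod-3 : ∃ λ T → + p - + 2 ≡ T * + 3 + ρ
  p-2≡ρ-mod-3 = T , (begin
    + p - + 2                                     ≡⟨ ∑-α ⟨
    ∑ α                                           ≡⟨ ∑-cong orbit-pointwise ⟨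
    ∑ (λ x → f x + f (mobius x) + f (mobius (mobius x)) + α x * δ (mobius x) x)
      ≡⟨ ∑-+ (λ x → f x + f (mobius x) + f (mobius (mobius x))) (λ x → α x * δ (mobius x) x) ⟩
    ∑ (λ x → f x + f (mobius x) + f (mobius (mobius x))) + ∑ (λ x → α x * δ (mobius x) x)
      ≡⟨ cong₂ _+_ (trans (∑-+ (λ x → f x + f (mobius x)) (λ x → f (mobius (mobius x))))
           (cong₂ _+_ (trans (∑-+ f (λ x → f (mobius x))) (cong (_+_ T) (∑-mobius f)))
             (trans (∑-mobius (λ x → f (mobius x))) (∑-mobius f)))) ∑-fixed ⟩
    (T + T + T) + ρ                               ≡⟨ cong (_+ ρ) (lem T) ⟩
    T * + 3 + ρ                                   ∎)
    where
    open ≡-Reasoning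
    f : F → ℤ
    f x = α x * orbit-min x
    T : ℤ
    T = ∑ f
    lem : ∀ t → t + t + t ≡ t * + 3
    lem = solve-∀

  -- As p = 3T + ρ + 2 and ρ is 0 or 2, the case ρ = 0 forces p ≡ 2 and the case ρ = 2 forces p ≡ 1
  -- modulo 3.
  ρ≡1+legendre3 : ρ ≡ + 1 + legendre3 p
  ρ≡1+legendre3 = by-cases ρ-values
    where
    T : ℤ
    T = proj₁ p-2≡ρ-mod-3
    p-eq : ∀ {r} → ρ ≡ r → + p ≡ T * + 3 + (r + + 2)
    p-eq refl = trans (lem (+ p)) (trans (cong (λ z → z + + 2) (proj₂ p-2≡ρ-mod-3))
        (ℤ.+-assoc (T * + 3) ρ (+ 2)))
      where
      lem : ∀ p → p ≡ p - + 2 + + 2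
      lem = solve-∀
    by-cases : ρ ≡ + 0 ⊎ ρ ≡ + 2 → ρ ≡ + 1 + legendre3 p
    by-cases (inj₁ ρ≡0) = trans ρ≡0 (sym (cong (λ l → + 1 + l) (legendre3-2 p
      (residue3 p 2 (s≤s (s≤s (s≤s z≤n))) T (trans (p-eq ρ≡0) (ℤ.+-comm (T * + 3) (+ 2)))))))
    by-cases (inj₂ ρ≡2) = trans ρ≡2 (sym (cong (λ l → + 1 + l) (legendre3-1 p
      (residue3 p 1 (s≤s (s≤s z≤n)) (T + + 1) (trans (p-eq ρ≡2) (lem T))))))
      where
      lem : ∀ T → T * + 3 + (+ 2 + + 2) ≡ + 1 + (T + + 1) * + 3
      lem = solve-∀

  -- Sums over tuples of nonzero elements

  ∑* : (F → ℤ) → ℤ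
  ∑* f = ∑ λ x → ν x * f x

  ∑*-cong : ∀ {f g : F → ℤ} → (∀ x → x ≢ 0# → f x ≡ g x) → ∑* f ≡ ∑* g
  ∑*-cong {f} {g} h = ∑-cong λ x → ν-*-cong x {f x} {g x} (h x)

  ∑*-cong′ : ∀ {f g : F → ℤ} → (∀ x → f x ≡ g x) → ∑* f ≡ ∑* g
  ∑*-cong′ h = ∑-cong λ x → cong (ν x *_) (h x)

  ∑*-+ : ∀ (f g : F → ℤ) → ∑* (λ x → f x + g x) ≡ ∑* f + ∑* g
  ∑*-+ f g = trans (∑-cong λ x → ℤ.*-distribˡ-+ (ν x) (f x) (g x)) (∑-+ (λ x → ν x * f x) (λ x → ν x * g x))

  ∑*-*ˡ : ∀ c (f : F → ℤ) → ∑* (λ x → c * f x) ≡ c * ∑* f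
  ∑*-*ˡ c f = trans (∑-cong λ x → lem (ν x) c (f x)) (∑-*ˡ c (λ x → ν x * f x))
    where
    lem : ∀ a b c → a * (b * c) ≡ b * (a * c)
    lem = solve-∀

  ∑*-const : ∀ c → ∑* (λ _ → c) ≡ + q * c
  ∑*-const c = trans (∑-*ʳ ν c) (cong (_* c) ∑-ν1)

  ∑*-∑ : ∀ (f : F → F → ℤ) → ∑* (λ x → ∑ (f x)) ≡ ∑ λ a → ∑* λ x → f x a
  ∑*-∑ f = trans (∑-cong λ x → sym (∑-*ˡ (ν x) (f x))) (∑-swap λ x a → ν x * f x a)

  ∑*-scale : ∀ {c} → c ≢ 0# → ∀ (f : F → ℤ) → ∑* (λ x → f (c ⊠ x)) ≡ ∑* f
  ∑*-scale {c} c≢0 f = trans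
    (∑-cong λ x → cong (_* f (c ⊠ x)) (ν-⇔
      (λ x≡0 → trans (cong (c ⊠_) x≡0) (⊠-zeroʳ c))
      (λ cx≡0 → ⊠-cancelˡ c≢0 (trans cx≡0 (sym (⊠-zeroʳ c))))))
    (∑-scale c≢0 (λ x → ν x * f x))

  ∑*-⁻¹ : ∀ (f : F → ℤ) → ∑* (λ x → f (x ⁻¹)) ≡ ∑* f
  ∑*-⁻¹ f = trans
    (∑-cong λ x → cong (_* f (x ⁻¹)) (ν-⇔
      (λ x≡0 → trans (cong _⁻¹ x≡0) ⁻¹-0)
      (λ eq → trans (sym (⁻¹-involutive x)) (trans (cong _⁻¹ eq) ⁻¹-0))))
    (∑-⁻¹ (λ x → ν x * f x))

  -- tuples j φ is the sum of φ (x₁ + … + xⱼ) (x₁⁻¹ + … + xⱼ⁻¹) over all nonzero x₁, …, xⱼ.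
  tuples : ℕ → (F → F → ℤ) → ℤ
  tuples zero    φ = φ 0# 0#
  tuples (suc j) φ = ∑* λ x → tuples j λ s t → φ (x ⊞ s) (x ⁻¹ ⊞ t)

  tuples-cong : ∀ j {φ ψ : F → F → ℤ} → (∀ s t → φ s t ≡ ψ s t) → tuples j φ ≡ tuples j ψ
  tuples-cong zero    h = h 0# 0#
  tuples-cong (suc j) h = ∑*-cong′ λ x → tuples-cong j λ s t → h (x ⊞ s) (x ⁻¹ ⊞ t)

  tuples-+ : ∀ j (φ ψ : F → F → ℤ) → tuples j (λ s t → φ s t + ψ s t) ≡ tuples j φ + tuples j ψ
  tuples-+ zero    φ ψ = refl
  tuples-+ (suc j) φ ψ = trans
    (∑*-cong′ λ x → tuples-+ j (λ s t → φ (x ⊞ s) (x ⁻¹ ⊞ t)) (λ s t → ψ (x ⊞ s) (x ⁻¹ ⊞ t)))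
    (∑*-+ (λ x → tuples j λ s t → φ (x ⊞ s) (x ⁻¹ ⊞ t)) (λ x → tuples j λ s t → ψ (x ⊞ s) (x ⁻¹ ⊞ t)))

  tuples-*ˡ : ∀ j c (φ : F → F → ℤ) → tuples j (λ s t → c * φ s t) ≡ c * tuples j φ
  tuples-*ˡ zero    c φ = refl
  tuples-*ˡ (suc j) c φ = trans
    (∑*-cong′ λ x → tuples-*ˡ j c (λ s t → φ (x ⊞ s) (x ⁻¹ ⊞ t)))
    (∑*-*ˡ c (λ x → tuples j λ s t → φ (x ⊞ s) (x ⁻¹ ⊞ t)))

  tuples-*ʳ : ∀ j (φ : F → F → ℤ) c → tuples j (λ s t → φ s t * c) ≡ tuples j φ * c
  tuples-*ʳ j φ c = trans (tuples-cong j λ s t → ℤ.*-comm (φ s t) c)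
    (trans (tuples-*ˡ j c φ) (ℤ.*-comm c (tuples j φ)))

  tuples-- : ∀ j (φ ψ : F → F → ℤ) → tuples j (λ s t → φ s t - ψ s t) ≡ tuples j φ - tuples j ψ
  tuples-- j φ ψ = begin
    tuples j (λ s t → φ s t - ψ s t)
      ≡⟨ tuples-cong j (λ s t → cong (_+_ (φ s t)) (sym (ℤ.-1*i≡-i (ψ s t)))) ⟩
    tuples j (λ s t → φ s t + ℤ.-1ℤ * ψ s t)
      ≡⟨ tuples-+ j φ (λ s t → ℤ.-1ℤ * ψ s t) ⟩
    tuples j φ + tuples j (λ s t → ℤ.-1ℤ * ψ s t)
      ≡⟨ cong (_+_ (tuples j φ)) (trans (tuples-*ˡ j ℤ.-1ℤ ψ) (ℤ.-1*i≡-i (tuples j ψ))) ⟩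
    tuples j φ - tuples j ψ ∎
    where open ≡-Reasoning

  tuples-∑ : ∀ j (φ : F → F → F → ℤ) → tuples j (λ s t → ∑ λ a → φ a s t) ≡ ∑ λ a → tuples j (φ a)
  tuples-∑ zero    φ = refl
  tuples-∑ (suc j) φ = trans
    (∑*-cong′ λ x → tuples-∑ j λ a s t → φ a (x ⊞ s) (x ⁻¹ ⊞ t))
    (∑*-∑ λ x a → tuples j λ s t → φ a (x ⊞ s) (x ⁻¹ ⊞ t))

  tuples-∑* : ∀ j (φ : F → F → F → ℤ) → tuples j (λ s t → ∑* λ a → φ a s t) ≡ ∑* λ a → tuples j (φ a)
  tuples-∑* j φ = trans (tuples-∑ j (λ a s t → ν a * φ a s t)) (∑-cong λ a → tuples-*ˡ j (ν a) (φ a))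

  tuples-const : ∀ j c → tuples j (λ _ _ → c) ≡ (+ q) ^ j * c
  tuples-const zero    c = sym (ℤ.*-identityˡ c)
  tuples-const (suc j) c = trans (∑*-const (tuples j λ _ _ → c))
    (trans (cong (+ q *_) (tuples-const j c)) (sym (ℤ.*-assoc (+ q) ((+ q) ^ j) c)))

  -- The substitution of c xᵢ for every entry multiplies the sum of the entries by c and the sum of
  -- their inverses by c⁻¹.
  tuples-scale : ∀ j {c} → c ≢ 0# → ∀ (φ : F → F → ℤ) →
                 tuples j (λ s t → φ (c ⊠ s) (c ⁻¹ ⊠ t)) ≡ tuples j φ
  tuples-scale zero    {c} c≢0 φ = cong₂ φ (⊠-zeroʳ c) (⊠-zeroʳ (c ⁻¹))
  tuples-scale (suc j) {c} c≢0 φ = begin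
    ∑* (λ x → tuples j λ s t → φ (c ⊠ (x ⊞ s)) (c ⁻¹ ⊠ (x ⁻¹ ⊞ t)))
      ≡⟨ ∑*-cong′ (λ x → tuples-cong j λ s t → cong₂ φ (⊠-distribˡ-⊞ c x s)
           (trans (⊠-distribˡ-⊞ (c ⁻¹) (x ⁻¹) t) (cong (_⊞ c ⁻¹ ⊠ t) (sym (⁻¹-⊠ c x))))) ⟩
    ∑* (λ x → tuples j λ s t → φ (c ⊠ x ⊞ c ⊠ s) ((c ⊠ x) ⁻¹ ⊞ c ⁻¹ ⊠ t))
      ≡⟨ ∑*-cong′ (λ x → tuples-scale j c≢0 λ s t → φ (c ⊠ x ⊞ s) ((c ⊠ x) ⁻¹ ⊞ t)) ⟩
    ∑* (λ x → tuples j λ s t → φ (c ⊠ x ⊞ s) ((c ⊠ x) ⁻¹ ⊞ t))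
      ≡⟨ ∑*-scale c≢0 (λ x → tuples j λ s t → φ (x ⊞ s) (x ⁻¹ ⊞ t)) ⟩
    tuples (suc j) φ ∎
    where open ≡-Reasoning

  -- The substitution of xᵢ⁻¹ for every entry exchanges the two sums.
  tuples-swap : ∀ j (φ : F → F → ℤ) → tuples j (λ s t → φ t s) ≡ tuples j φ
  tuples-swap zero    φ = refl
  tuples-swap (suc j) φ = begin
    ∑* (λ x → tuples j λ s t → φ (x ⁻¹ ⊞ t) (x ⊞ s))
      ≡⟨ ∑*-cong′ (λ x → tuples-swap j λ s t → φ (x ⁻¹ ⊞ s) (x ⊞ t)) ⟩
    ∑* (λ x → tuples j λ s t → φ (x ⁻¹ ⊞ s) (x ⊞ t))
      ≡⟨ ∑*-cong′ (λ x → tuples-cong j λ s t → cong (λ y → φ (x ⁻¹ ⊞ s) (y ⊞ t)) (sym (⁻¹-involutive x))) ⟩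
    ∑* (λ x → tuples j λ s t → φ (x ⁻¹ ⊞ s) ((x ⁻¹) ⁻¹ ⊞ t))
      ≡⟨ ∑*-⁻¹ (λ x → tuples j λ s t → φ (x ⊞ s) (x ⁻¹ ⊞ t)) ⟩
    tuples (suc j) φ ∎
    where open ≡-Reasoning

  tuples-append : ∀ i j (φ : F → F → ℤ) →
                  tuples (i ℕ.+ j) φ ≡ tuples i λ s t → tuples j λ s′ t′ → φ (s ⊞ s′) (t ⊞ t′)
  tuples-append zero    j φ = tuples-cong j λ s t → cong₂ φ (sym (⊞-identityˡ s)) (sym (⊞-identityˡ t))
  tuples-append (suc i) j φ = ∑*-cong′ λ x → trans
    (tuples-append i j λ s t → φ (x ⊞ s) (x ⁻¹ ⊞ t))
    (tuples-cong i λ s t → tuples-cong j λ s′ t′ →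
      cong₂ φ (sym (⊞-assoc x s s′)) (sym (⊞-assoc (x ⁻¹) t t′)))

  ∑*-δ-⊞ : ∀ s a → ∑* (λ x → δ (x ⊞ s) a) ≡ + 1 - δ s a
  ∑*-δ-⊞ s a = trans (∑-ν (λ x → δ (x ⊞ s) a))
    (cong₂ _-_ (trans (∑-shift s (λ x → δ x a)) (∑-δ1 a)) (cong (λ s → δ s a) (⊞-identityˡ s)))

  -- If the other entries have sum s, the additional one must be a - s, which is nonzero exactly
  -- when s ≠ a. The recursion serves for a = 0 in `p*M` and for a = 1 in `∑-n`.
  tuples-δ-suc : ∀ j a → tuples (suc j) (λ s _ → δ s a) ≡ (+ q) ^ j - tuples j (λ s _ → δ s a)
  tuples-δ-suc j a = begin
    ∑* (λ x → tuples j λ s _ → δ (x ⊞ s) a)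
      ≡⟨ tuples-∑* j (λ x s _ → δ (x ⊞ s) a) ⟨
    tuples j (λ s _ → ∑* λ x → δ (x ⊞ s) a)
      ≡⟨ tuples-cong j (λ s _ → ∑*-δ-⊞ s a) ⟩
    tuples j (λ s _ → + 1 - δ s a)
      ≡⟨ tuples-- j (λ _ _ → + 1) (λ s _ → δ s a) ⟩
    tuples j (λ _ _ → + 1) - tuples j (λ s _ → δ s a)
      ≡⟨ cong (_- tuples j (λ s _ → δ s a)) (trans (tuples-const j (+ 1)) (ℤ.*-identityʳ ((+ q) ^ j))) ⟩
    (+ q) ^ j - tuples j (λ s _ → δ s a) ∎
    where open ≡-Reasoning

  count : ℕ → F → F → ℤ
  count j a b = tuples j λ s t → δ s a * δ t b

  tuples-expand : ∀ j (φ : F → F → ℤ) → tuples j φ ≡ ∑ λ a → ∑ λ b → count j a b * φ a b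
  tuples-expand j φ = begin
    tuples j φ
      ≡⟨ tuples-cong j pointwise ⟩
    tuples j (λ s t → ∑ λ a → ∑ λ b → δ s a * δ t b * φ a b)
      ≡⟨ tuples-∑ j (λ a s t → ∑ λ b → δ s a * δ t b * φ a b) ⟩
    ∑ (λ a → tuples j λ s t → ∑ λ b → δ s a * δ t b * φ a b)
      ≡⟨ ∑-cong (λ a → tuples-∑ j (λ b s t → δ s a * δ t b * φ a b)) ⟩
    ∑ (λ a → ∑ λ b → tuples j λ s t → δ s a * δ t b * φ a b)
      ≡⟨ ∑-cong (λ a → ∑-cong λ b → tuples-*ʳ j (λ s t → δ s a * δ t b) (φ a b)) ⟩
    ∑ (λ a → ∑ λ b → count j a b * φ a b) ∎
    where
    open ≡-Reasoning
    pointwise : ∀ s t → φ s t ≡ ∑ λ a → ∑ λ b → δ s a * δ t b * φ a b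
    pointwise s t = sym (begin
      ∑ (λ a → ∑ λ b → δ s a * δ t b * φ a b)
        ≡⟨ ∑-cong (λ a → trans (∑-cong λ b → trans (cong₂ (λ d e → d * e * φ a b) (δ-sym s a) (δ-sym t b))
             (ℤ.*-assoc (δ a s) (δ b t) (φ a b))) (∑-*ˡ (δ a s) (λ b → δ b t * φ a b))) ⟩
      ∑ (λ a → δ a s * ∑ λ b → δ b t * φ a b)
        ≡⟨ ∑-δ s (λ a → ∑ λ b → δ b t * φ a b) ⟩
      ∑ (λ b → δ b t * φ s b)
        ≡⟨ ∑-δ t (φ s) ⟩
      φ s t ∎)

  count-scale : ∀ j {c} → c ≢ 0# → ∀ a b → count j (c ⊠ a) (c ⁻¹ ⊠ b) ≡ count j a b
  count-scale j {c} c≢0 a b = trans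
    (sym (tuples-scale j c≢0 λ s t → δ s (c ⊠ a) * δ t (c ⁻¹ ⊠ b)))
    (tuples-cong j λ s t → cong₂ _*_
      (δ-⇔ (⊠-cancelˡ c≢0) (cong (c ⊠_)))
      (δ-⇔ (⊠-cancelˡ (⁻¹-≢0 c≢0)) (cong (c ⁻¹ ⊠_))))

  count-swap : ∀ j a b → count j a b ≡ count j b a
  count-swap j a b = trans (tuples-cong j λ s t → ℤ.*-comm (δ s a) (δ t b))
    (tuples-swap j λ s t → δ s b * δ t a)

  -- Reduction of the sixth moment to the counts n k

  ∑-split : ∀ (f : F → ℤ) → ∑ f ≡ f 0# + ∑* f
  ∑-split f = trans (lem (∑ f) (f 0#)) (cong (_+_ (f 0#)) (sym (∑-ν f)))
    where
    lem : ∀ a b → a ≡ b + (a - b)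
    lem = solve-∀

  -- V t is the coefficient of ζᵗ in ∑ᵤ Kᵤ⁶.
  V : F → ℤ
  V t = ∑* λ u → tuples 6 λ s s′ → δ t (s ⊞ u ⊠ s′)

  -- Replace every xᵢ by c xᵢ and then u by c²u. This is Galois invariance: ζ ↦ ζᶜ takes K with
  -- parameter u to K with parameter c²u.
  V-nonzero : ∀ {c} → c ≢ 0# → V c ≡ V 1#
  V-nonzero {c} c≢0 = begin
    ∑* (λ u → tuples 6 λ s s′ → δ c (s ⊞ u ⊠ s′))
      ≡⟨ ∑*-cong′ (λ u → sym (tuples-scale 6 c≢0 λ s s′ → δ c (s ⊞ u ⊠ s′))) ⟩
    ∑* (λ u → tuples 6 λ s s′ → δ c (c ⊠ s ⊞ u ⊠ (c ⁻¹ ⊠ s′)))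
      ≡⟨ ∑*-cong′ (λ u → tuples-cong 6 λ s s′ → δ-⇔
           (λ eq → ⊠-cancelˡ c≢0 (trans (⊠-identityʳ c) (trans eq (factor u s s′))))
           (λ eq → trans (sym (⊠-identityʳ c)) (trans (cong (c ⊠_) eq) (sym (factor u s s′))))) ⟩
    ∑* (λ u → tuples 6 λ s s′ → δ 1# (s ⊞ c ⁻¹ ⊠ c ⁻¹ ⊠ u ⊠ s′))
      ≡⟨ ∑*-scale (⊠-≢0 (⁻¹-≢0 c≢0) (⁻¹-≢0 c≢0)) (λ u → tuples 6 λ s s′ → δ 1# (s ⊞ u ⊠ s′)) ⟩
    V 1# ∎
    where
    open ≡-Reasoning
    factor : ∀ u s s′ → c ⊠ s ⊞ u ⊠ (c ⁻¹ ⊠ s′) ≡ c ⊠ (s ⊞ c ⁻¹ ⊠ c ⁻¹ ⊠ u ⊠ s′)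
    factor u s s′ = trans (cong (λ z → c ⊠ s ⊞ u ⊠ z) (sym (⁻¹-cancelʳ c≢0 (c ⁻¹ ⊠ s′))))
      (solve 5 (λ c s u i s′ → c :* s :+ u :* (c :* (i :* (i :* s′))) := c :* (s :+ i :* i :* u :* s′)) refl c s
          u (c ⁻¹) s′)

  -- The augmentation ζ ↦ 1 of the group ring, under which each Kᵤ becomes q.
  ∑-V : ∑ V ≡ + q * (+ q) ^ 6
  ∑-V = begin
    ∑ (λ t → ∑* λ u → tuples 6 λ s s′ → δ t (s ⊞ u ⊠ s′))
      ≡⟨ ∑*-∑ (λ u t → tuples 6 λ s s′ → δ t (s ⊞ u ⊠ s′)) ⟨
    ∑* (λ u → ∑ λ t → tuples 6 λ s s′ → δ t (s ⊞ u ⊠ s′))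
      ≡⟨ ∑*-cong′ (λ u → sym (tuples-∑ 6 (λ t s s′ → δ t (s ⊞ u ⊠ s′)))) ⟩
    ∑* (λ u → tuples 6 λ s s′ → ∑ λ t → δ t (s ⊞ u ⊠ s′))
      ≡⟨ ∑*-cong′ (λ u → tuples-cong 6 λ s s′ → ∑-δ1 (s ⊞ u ⊠ s′)) ⟩
    ∑* (λ u → tuples 6 λ _ _ → + 1)
      ≡⟨ ∑*-const (tuples 6 λ _ _ → + 1) ⟩
    + q * tuples 6 (λ _ _ → + 1)
      ≡⟨ cong (+ q *_) (trans (tuples-const 6 (+ 1)) (ℤ.*-identityʳ ((+ q) ^ 6))) ⟩
    + q * (+ q) ^ 6 ∎
    where open ≡-Reasoning

  V-total : V 0# + + q * V 1# ≡ + q * (+ q) ^ 6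
  V-total = trans (cong (_+_ (V 0#)) (sym (trans (∑*-cong λ c c≢0 → V-nonzero c≢0) (∑*-const (V 1#)))))
    (trans (sym (∑-split V)) ∑-V)

  -- The number of admissible u is q if s and s′ both vanish, 0 if exactly one does, and 1
  -- otherwise, namely u = -s/s′. A single formula in δ lets the sum over tuples separate.
  V-0-kernel : ∀ s s′ → ∑* (λ u → δ 0# (s ⊞ u ⊠ s′)) ≡ (+ 1 - δ s 0#) - δ s′ 0# + + p * (δ s 0# * δ s′ 0#)
  V-0-kernel s s′ = by-cases (s′ ≟ 0#)
    where
    open ≡-Reasoning
    zero-case : ∀ q d → q * d ≡ (+ 1 - d) - + 1 + (+ 1 + q) * (d * + 1)
    zero-case = solve-∀
    nonzero-case : ∀ p d → + 1 - d ≡ (+ 1 - d) - + 0 + p * (d * + 0)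
    nonzero-case = solve-∀
    by-cases : Dec (s′ ≡ 0#) → _
    by-cases (yes s′≡0) = begin
      ∑* (λ u → δ 0# (s ⊞ u ⊠ s′))
        ≡⟨ ∑*-cong′ (λ u → trans (cong (δ 0#) (trans (cong (λ z → s ⊞ u ⊠ z) s′≡0)
             (solve 2 (λ s u → s :+ u :* con (+ 0) := s) refl s u))) (δ-sym 0# s)) ⟩
      ∑* (λ u → δ s 0#)
        ≡⟨ ∑*-const (δ s 0#) ⟩
      + q * δ s 0#
        ≡⟨ zero-case (+ q) (δ s 0#) ⟩
      (+ 1 - δ s 0#) - + 1 + + p * (δ s 0# * + 1)
        ≡⟨ cong (λ d → (+ 1 - δ s 0#) - d + + p * (δ s 0# * d)) (δ-yes s′≡0) ⟨
      (+ 1 - δ s 0#) - δ s′ 0# + + p * (δ s 0# * δ s′ 0#) ∎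
    by-cases (no s′≢0) = begin
      ∑* (λ u → δ 0# (s ⊞ u ⊠ s′))
        ≡⟨ ∑*-cong′ (λ u → trans (δ-sym 0# (s ⊞ u ⊠ s′)) (cong (λ z → δ z 0#)
             (solve 3 (λ s u s′ → s :+ u :* s′ := s′ :* u :+ s) refl s u s′))) ⟩
      ∑* (λ u → δ (s′ ⊠ u ⊞ s) 0#)
        ≡⟨ ∑*-scale s′≢0 (λ u → δ (u ⊞ s) 0#) ⟩
      ∑* (λ u → δ (u ⊞ s) 0#)
        ≡⟨ ∑*-δ-⊞ s 0# ⟩
      + 1 - δ s 0#
        ≡⟨ nonzero-case (+ p) (δ s 0#) ⟩
      (+ 1 - δ s 0#) - + 0 + + p * (δ s 0# * + 0)
        ≡⟨ cong (λ d → (+ 1 - δ s 0#) - d + + p * (δ s 0# * d)) (δ-no s′≢0) ⟨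
      (+ 1 - δ s 0#) - δ s′ 0# + + p * (δ s 0# * δ s′ 0#) ∎

  M : ℤ
  M = tuples 6 λ s _ → δ s 0#

  V-0 : V 0# ≡ ((+ q) ^ 6 - M) - M + + p * count 6 0# 0#
  V-0 = begin
    V 0#
      ≡⟨ tuples-∑* 6 (λ u s s′ → δ 0# (s ⊞ u ⊠ s′)) ⟨
    tuples 6 (λ s s′ → ∑* λ u → δ 0# (s ⊞ u ⊠ s′))
      ≡⟨ tuples-cong 6 V-0-kernel ⟩
    tuples 6 (λ s s′ → (+ 1 - δ s 0#) - δ s′ 0# + + p * (δ s 0# * δ s′ 0#))
      ≡⟨ tuples-+ 6 (λ s s′ → (+ 1 - δ s 0#) - δ s′ 0#) (λ s s′ → + p * (δ s 0# * δ s′ 0#)) ⟩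
    tuples 6 (λ s s′ → (+ 1 - δ s 0#) - δ s′ 0#) + tuples 6 (λ s s′ → + p * (δ s 0# * δ s′ 0#))
      ≡⟨ cong₂ _+_
           (trans (tuples-- 6 (λ s _ → + 1 - δ s 0#) (λ _ s′ → δ s′ 0#))
             (cong₂ _-_ (trans (tuples-- 6 (λ _ _ → + 1) (λ s _ → δ s 0#))
                 (cong (_- M) (trans (tuples-const 6 (+ 1)) (ℤ.*-identityʳ ((+ q) ^ 6)))))
               (tuples-swap 6 (λ s _ → δ s 0#))))
           (tuples-*ˡ 6 (+ p) (λ s s′ → δ s 0# * δ s′ 0#)) ⟩
    ((+ q) ^ 6 - M) - M + + p * count 6 0# 0# ∎
    where open ≡-Reasoning

  -- The recursion makes M an alternating sum of powers of q, which the factor p = 1 + q telescopes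
  -- without any division.
  p*M : + p * M ≡ (+ q) ^ 6 + + q
  p*M = trans (cong (+ p *_) M-value) (lem (+ q))
    where
    Q : ℤ
    Q = + q
    step : ∀ j {x} → tuples j (λ s _ → δ s 0#) ≡ x → tuples (suc j) (λ s _ → δ s 0#) ≡ Q ^ j - x
    step j refl = tuples-δ-suc j 0#
    M-value : M ≡ Q ^ 5 - (Q ^ 4 - (Q ^ 3 - (Q ^ 2 - (Q ^ 1 - (Q ^ 0 - + 1)))))
    M-value = step 5 (step 4 (step 3 (step 2 (step 1 (step 0 (δ-yes refl))))))
    lem : ∀ Q → (+ 1 + Q) * ((Q * (Q * (Q * (Q * (Q * + 1))))) -
        ((Q * (Q * (Q * (Q * + 1)))) - ((Q * (Q * (Q * + 1))) -
        ((Q * (Q * + 1)) - ((Q * + 1) - ((+ 1) - + 1)))))) ≡ (Q * (Q * (Q * (Q * (Q * (Q * + 1)))))) + Q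
    lem = solve-∀

  n : F → ℤ
  n k = count 3 1# k

  -- Scaling by a carries the pair (1, ab) to (a, b), so for a ≠ 0 only the product matters.
  count-nonzero : ∀ {a} → a ≢ 0# → ∀ b → count 3 a b ≡ n (a ⊠ b)
  count-nonzero {a} a≢0 b = trans
    (cong₂ (count 3) (sym (⊠-identityʳ a)) (sym (⁻¹-cancelˡ a≢0 b)))
    (count-scale 3 a≢0 1# (a ⊠ b))

  count-neg : ∀ j a b → count j (neg a) (neg b) ≡ count j a b
  count-neg j a b = trans (cong₂ (count j)
      (solve 1 (λ a → :- a := (:- con (+ 1)) :* a) refl a)
      (trans (solve 1 (λ b → :- b := (:- con (+ 1)) :* b) refl b)
          (cong (_⊠ b) (⁻¹-unique {neg 1#} {neg 1#} -1²≡1))))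
    (count-scale j (neg-≢0 1≢0) a b)
    where
    -1²≡1 : neg 1# ⊠ neg 1# ≡ 1#
    -1²≡1 = solve 0 ((:- con (+ 1)) :* (:- con (+ 1)) := con (+ 1)) refl

  -- The second triple must have the opposite sums, and by `count-neg` there are as many such
  -- triples as with the sums of the first.
  count-6-squares : count 6 0# 0# ≡ ∑ λ a → ∑ λ b → count 3 a b * count 3 a b
  count-6-squares = begin
    count 6 0# 0#
      ≡⟨ tuples-append 3 3 (λ s t → δ s 0# * δ t 0#) ⟩
    tuples 3 (λ s t → tuples 3 λ s′ t′ → δ (s ⊞ s′) 0# * δ (t ⊞ t′) 0#)
      ≡⟨ tuples-cong 3 (λ s t → trans
           (tuples-cong 3 λ s′ t′ → cong₂ _*_ (opposite s s′) (opposite t t′))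
           (count-neg 3 s t)) ⟩
    tuples 3 (count 3)
      ≡⟨ tuples-expand 3 (count 3) ⟩
    ∑ (λ a → ∑ λ b → count 3 a b * count 3 a b) ∎
    where
    open ≡-Reasoning
    opposite : ∀ s s′ → δ (s ⊞ s′) 0# ≡ δ s′ (neg s)
    opposite s s′ = δ-⇔
      (λ eq → trans (solve 2 (λ s s′ → s′ := (s :+ s′) :- s) refl s s′)
          (trans (cong (_⊟ s) eq) (⊞-identityˡ (neg s))))
      (λ eq → trans (cong (s ⊞_) eq) (≡⇒⊟≡0 refl))

  -- The pair (0, 0) stands alone; each of the q pairs with a = 0 and b ≠ 0 gives n(0)² by symmetry;
  -- for each of the q values a ≠ 0 the map b ↦ ab permutes the field.
  count-6 : count 6 0# 0# ≡ count 3 0# 0# * count 3 0# 0# + + q * (n 0# * n 0#) + + q * ∑ (λ k → n k * n k)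
  count-6 = begin
    count 6 0# 0#      ≡⟨ count-6-squares ⟩
    ∑ G                ≡⟨ ∑-split G ⟩
    G 0# + ∑* G        ≡⟨ cong₂ _+_ G-0 (trans (∑*-cong λ a a≢0 → G-nonzero a≢0)
        (∑*-const (∑ λ k → n k * n k))) ⟩
    count 3 0# 0# * count 3 0# 0# + + q * (n 0# * n 0#) + + q * ∑ (λ k → n k * n k) ∎
    where
    open ≡-Reasoning
    G : F → ℤ
    G a = ∑ λ b → count 3 a b * count 3 a b
    G-nonzero : ∀ {a} → a ≢ 0# → G a ≡ ∑ λ k → n k * n k
    G-nonzero {a} a≢0 = trans (∑-cong λ b → cong (λ c → c * c) (count-nonzero a≢0 b))
      (∑-scale a≢0 (λ k → n k * n k))
    G-0 : G 0# ≡ count 3 0# 0# * count 3 0# 0# + + q * (n 0# * n 0#)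
    G-0 = trans (∑-split λ b → count 3 0# b * count 3 0# b)
      (cong (_+_ (count 3 0# 0# * count 3 0# 0#))
        (trans (∑*-cong λ b b≢0 → cong (λ c → c * c) (trans (count-swap 3 0# b)
            (trans (count-nonzero b≢0 0#) (cong n (⊠-zeroʳ b)))))
          (∑*-const (n 0# * n 0#))))

  -- The combination q(V(0) - V(1)) = pV(0) - (V(0) + qV(1)) needs only V(0) and the total of the
  -- coefficients. Writing the count of sextuples as qN′ then allows q to be cancelled.
  moment : ∀ N′ → count 6 0# 0# ≡ + q * N′ → V 0# - V 1# ≡ + p * + p * N′ - (+ q) ^ 5 - + 2
  moment N′ N-eq = ℤ.*-cancelˡ-≡ (+ q) _ _ {{q-nonZero}} (begin
    + q * (V 0# - V 1#)
      ≡⟨ lem₁ (+ q) (V 0#) (V 1#) ⟩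
    + p * V 0# - (V 0# + + q * V 1#)
      ≡⟨ cong₂ (λ a b → + p * a - b) V-0 V-total ⟩
    + p * (((+ q) ^ 6 - M) - M + + p * count 6 0# 0#) - + q * (+ q) ^ 6
      ≡⟨ cong (λ N → + p * (((+ q) ^ 6 - M) - M + + p * N) - + q * (+ q) ^ 6) N-eq ⟩
    + p * (((+ q) ^ 6 - M) - M + + p * (+ q * N′)) - + q * (+ q) ^ 6
      ≡⟨ lem₂ (+ q) M N′ ⟩
    + p * + p * (+ q * N′) + (+ q) ^ 6 - + 2 * (+ p * M)
      ≡⟨ cong (λ m → + p * + p * (+ q * N′) + (+ q) ^ 6 - + 2 * m) p*M ⟩
    + p * + p * (+ q * N′) + (+ q) ^ 6 - + 2 * ((+ q) ^ 6 + + q)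
      ≡⟨ lem₃ (+ q) N′ ⟩
    + q * (+ p * + p * N′ - (+ q) ^ 5 - + 2) ∎)
    where
    open ≡-Reasoning
    q-nonZero : ℤ.NonZero (+ q)
    q-nonZero = ℕ.>-nonZero (ℕ.≤-trans (s≤s z≤n) (ℕ.s≤s⁻¹ 5≤p))
    lem₁ : ∀ q v w → q * (v - w) ≡ (+ 1 + q) * v - (v + q * w)
    lem₁ = solve-∀
    lem₂ : ∀ q m N → (+ 1 + q) * (((q * (q * (q * (q * (q * (q * + 1)))))) - m) - m + (+ 1 + q) * (q * N)) - q *
        (q * (q * (q * (q * (q * (q * + 1))))))
         ≡ (+ 1 + q) * (+ 1 + q) * (q * N) + (q * (q * (q * (q * (q * (q * + 1)))))) - + 2 * ((+ 1 + q) * m)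
    lem₂ = solve-∀
    lem₃ : ∀ q N → (+ 1 + q) * (+ 1 + q) * (q * N) + (q * (q * (q * (q * (q * (q * + 1)))))) - + 2 *
        ((q * (q * (q * (q * (q * (q * + 1)))))) + q)
         ≡ q * ((+ 1 + q) * (+ 1 + q) * N - (q * (q * (q * (q * (q * + 1))))) - + 2)
    lem₃ = solve-∀

  -- Evaluation of the counts n k

  ⊞≡⇒≡⊟ : ∀ {x y z} → x ⊞ y ≡ z → y ≡ z ⊟ x
  ⊞≡⇒≡⊟ {x} {y} refl = solve 2 (λ x y → y := x :+ y :- x) refl x y

  ≡⊟⇒⊞≡ : ∀ {x y z} → y ≡ z ⊟ x → x ⊞ y ≡ z
  ≡⊟⇒⊞≡ {x} {y} {z} refl = solve 2 (λ x z → x :+ (z :- x) := z) refl x z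

  count-suc : ∀ j a b → count (suc j) a b ≡ ∑* λ x → count j (a ⊟ x) (b ⊟ x ⁻¹)
  count-suc j a b = ∑*-cong′ λ x → tuples-cong j λ s t →
    cong₂ _*_ (δ-⇔ ⊞≡⇒≡⊟ ≡⊟⇒⊞≡) (δ-⇔ ⊞≡⇒≡⊟ ≡⊟⇒⊞≡)

  -- The only candidate is x = a, with inverse b; the equation ab = 1 already excludes a = 0.
  count-1 : ∀ a b → count 1 a b ≡ δ (a ⊠ b) 1#
  count-1 a b = begin
    count 1 a b
      ≡⟨ ∑-cong (λ x → trans (cong₂ (λ d e → ν x * (d * e)) (cong (λ y → δ y a) (⊞0 x))
          (cong (λ y → δ y b) (⊞0 (x ⁻¹))))
           (lem (ν x) (δ x a) (δ (x ⁻¹) b))) ⟩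
    ∑ (λ x → δ x a * (ν x * δ (x ⁻¹) b))
      ≡⟨ ∑-δ a (λ x → ν x * δ (x ⁻¹) b) ⟩
    ν a * δ (a ⁻¹) b
      ≡⟨ by-cases (a ≟ 0#) ⟩
    δ (a ⊠ b) 1# ∎
    where
    open ≡-Reasoning
    ⊞0 : ∀ x → x ⊞ 0# ≡ x
    ⊞0 = solve 1 (λ x → x :+ con (+ 0) := x) refl
    lem : ∀ a b c → a * (b * c) ≡ b * (a * c)
    lem = solve-∀
    by-cases : Dec (a ≡ 0#) → ν a * δ (a ⁻¹) b ≡ δ (a ⊠ b) 1#
    by-cases (yes a≡0) = trans (cong (_* δ (a ⁻¹) b) (ν-0 a≡0))
      (sym (δ-no λ eq → ⊠-factorˡ-≢0 eq a≡0))
    by-cases (no a≢0) = trans (cong (_* δ (a ⁻¹) b) (ν-1 a≢0)) (trans (ℤ.*-identityˡ (δ (a ⁻¹) b))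
      (δ-⇔ (λ eq → trans (cong (a ⊠_) (sym eq)) (⁻¹-inverseʳ a≢0)) (λ eq → sym (⁻¹-unique eq))))

  -- The second entry is a - x, subject to (a - x)(b - x⁻¹) = 1; multiplication by x ≠ 0 turns this
  -- into the quadratic.
  count-2-quadratic : ∀ a b → count 2 a b ≡ ∑* λ x → δ (b ⊠ x ⊠ x ⊟ a ⊠ b ⊠ x ⊞ a) 0#
  count-2-quadratic a b = trans (count-suc 1 a b) (∑*-cong λ x x≢0 → trans (count-1 (a ⊟ x) (b ⊟ x ⁻¹))
    (δ-⇔ (λ eq → trans (poly x x≢0)
        (trans (cong (λ z → x ⊠ (1# ⊟ z)) eq) (solve 1 (λ x → x :* (con (+ 1) :- con (+ 1)) := con (+ 0)) refl
        x)))
         (λ eq → sym (⊟≡0⇒≡ (⊠-cancelˡ x≢0 (trans (sym (poly x x≢0)) (trans eq (sym (⊠-zeroʳ x)))))))))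
    where
    open ≡-Reasoning
    poly : ∀ x → x ≢ 0# → b ⊠ x ⊠ x ⊟ a ⊠ b ⊠ x ⊞ a ≡ x ⊠ (1# ⊟ (a ⊟ x) ⊠ (b ⊟ x ⁻¹))
    poly x x≢0 = begin
      b ⊠ x ⊠ x ⊟ a ⊠ b ⊠ x ⊞ a
        ≡⟨ solve 3 (λ a b x → b :* x :* x :- a :* b :* x :+ a := x :* (con (+ 1) :- (a :- x) :* b) :+ (a :- x)
            :* con (+ 1)) refl a b x ⟩
      x ⊠ (1# ⊟ (a ⊟ x) ⊠ b) ⊞ (a ⊟ x) ⊠ 1#
        ≡⟨ cong (λ z → x ⊠ (1# ⊟ (a ⊟ x) ⊠ b) ⊞ (a ⊟ x) ⊠ z) (⁻¹-inverseʳ x≢0) ⟨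
      x ⊠ (1# ⊟ (a ⊟ x) ⊠ b) ⊞ (a ⊟ x) ⊠ (x ⊠ x ⁻¹)
        ≡⟨ solve 4 (λ a b x i → x :* (con (+ 1) :- (a :- x) :* b) :+ (a :- x) :* (x :* i)
             := x :* (con (+ 1) :- (a :- x) :* (b :- i))) refl a b x (x ⁻¹) ⟩
      x ⊠ (1# ⊟ (a ⊟ x) ⊠ (b ⊟ x ⁻¹)) ∎

  -- The argument of `roots` is the discriminant of the quadratic. Since a ≠ 0, x = 0 is not a zero
  -- and may be included; since b ≠ 0, the square can be completed.
  count-2-nonzero : ∀ {a b} → a ≢ 0# → b ≢ 0# → count 2 a b ≡ roots (a ⊠ b ⊠ (a ⊠ b ⊟ ⟦ + 4 ⟧))
  count-2-nonzero {a} {b} a≢0 b≢0 = begin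
    count 2 a b
      ≡⟨ count-2-quadratic a b ⟩
    ∑* (λ x → δ (quadratic x) 0#)
      ≡⟨ ∑-ν (λ x → δ (quadratic x) 0#) ⟩
    ∑ (λ x → δ (quadratic x) 0#) - δ (quadratic 0#) 0#
      ≡⟨ cong (λ d → ∑ (λ x → δ (quadratic x) 0#) - d) (δ-no λ eq → a≢0 (trans (sym quadratic-0) eq)) ⟩
    ∑ (λ x → δ (quadratic x) 0#) - + 0
      ≡⟨ ℤ.+-identityʳ (∑ λ x → δ (quadratic x) 0#) ⟩
    ∑ (λ x → δ (quadratic x) 0#)
      ≡⟨ ∑-cong (λ x → δ-⇔
           (λ eq → ⊟≡0⇒≡ (trans (sym (complete x)) (trans (cong (⟦ + 4 ⟧ ⊠ b ⊠_) eq) (⊠-zeroʳ _))))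
           (λ eq → ⊠-cancelˡ (⊠-≢0 4≢0 b≢0) (trans (complete x) (trans (≡⇒⊟≡0 eq) (sym (⊠-zeroʳ _)))))) ⟩
    ∑ (λ x → δ (linear x ⊠ linear x) D)
      ≡⟨ ∑-scale (⊠-≢0 2≢0 b≢0) (λ w → δ ((w ⊞ neg (a ⊠ b)) ⊠ (w ⊞ neg (a ⊠ b))) D) ⟩
    ∑ (λ w → δ ((w ⊞ neg (a ⊠ b)) ⊠ (w ⊞ neg (a ⊠ b))) D)
      ≡⟨ ∑-shift (neg (a ⊠ b)) (λ w → δ (w ⊠ w) D) ⟩
    roots D ∎
    where
    open ≡-Reasoning
    D : F
    D = a ⊠ b ⊠ (a ⊠ b ⊟ ⟦ + 4 ⟧)
    quadratic linear : F → F
    quadratic x = b ⊠ x ⊠ x ⊟ a ⊠ b ⊠ x ⊞ a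
    linear x = ⟦ + 2 ⟧ ⊠ b ⊠ x ⊟ a ⊠ b
    quadratic-0 : quadratic 0# ≡ a
    quadratic-0 = solve 2 (λ a b → b :* con (+ 0) :* con (+ 0) :- a :* b :* con (+ 0) :+ a := a) refl a b
    complete : ∀ x → ⟦ + 4 ⟧ ⊠ b ⊠ quadratic x ≡ linear x ⊠ linear x ⊟ D
    complete x = solve 3 (λ a b x → con (+ 4) :* b :* (b :* x :* x :- a :* b :* x :+ a)
      := (con (+ 2) :* b :* x :- a :* b) :* (con (+ 2) :* b :* x :- a :* b) :- a :* b :* (a :* b :- con (+ 4)))
          refl a b x

  count-2-0ʳ : ∀ {a b} → a ≢ 0# → b ≡ 0# → count 2 a b ≡ + 0
  count-2-0ʳ {a} a≢0 refl = trans (count-2-quadratic a 0#) (trans (∑*-cong′ λ x → δ-no λ eq → a≢0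
    (trans (solve 2 (λ a x → a := con (+ 0) :* x :* x :- a :* con (+ 0) :* x :+ a) refl a x) eq))
    (trans (∑*-const (+ 0)) (ℤ.*-zeroʳ (+ q))))

  count-2-0ˡ : ∀ {a b} → a ≡ 0# → b ≢ 0# → count 2 a b ≡ + 0
  count-2-0ˡ {a} {b} a≡0 b≢0 = trans (count-swap 2 a b) (count-2-0ʳ b≢0 a≡0)

  count-2-00 : ∀ {a b} → a ≡ 0# → b ≡ 0# → count 2 a b ≡ + q
  count-2-00 refl refl = trans (count-2-quadratic 0# 0#) (trans (∑*-cong′ λ x → δ-yes
    (solve 1 (λ x → con (+ 0) :* x :* x :- con (+ 0) :* con (+ 0) :* x :+ con (+ 0) := con (+ 0)) refl x))
    (trans (∑*-const (+ 1)) (ℤ.*-identityʳ (+ q))))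

  -- If z is one entry, the other two have sums -z and -z⁻¹ with product 1, so the discriminant is 1
  -- · (1 - 4) = -3 for every z.
  count-3-00 : count 3 0# 0# ≡ + q * ρ
  count-3-00 = begin
    count 3 0# 0#                                        ≡⟨ count-suc 2 0# 0# ⟩
    ∑* (λ z → count 2 (0# ⊟ z) (0# ⊟ z ⁻¹))              ≡⟨ ∑*-cong (λ z z≢0 → trans
      (count-2-nonzero (λ eq → neg-≢0 z≢0 (trans (sym (⊞-identityˡ _)) eq))
                       (λ eq → neg-≢0 (⁻¹-≢0 z≢0) (trans (sym (⊞-identityˡ _)) eq)))
      (cong roots (disc z z≢0))) ⟩
    ∑* (λ z → ρ)                                         ≡⟨ ∑*-const ρ ⟩
    + q * ρ                                              ∎
    where
    open ≡-Reasoning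
    prod : ∀ z → z ≢ 0# → (0# ⊟ z) ⊠ (0# ⊟ z ⁻¹) ≡ 1#
    prod z z≢0 = trans (solve 2 (λ z i → (con (+ 0) :- z) :* (con (+ 0) :- i) := z :* i) refl z (z ⁻¹))
        (⁻¹-inverseʳ z≢0)
    disc : ∀ z → z ≢ 0# → (0# ⊟ z) ⊠ (0# ⊟ z ⁻¹) ⊠ ((0# ⊟ z) ⊠ (0# ⊟ z ⁻¹) ⊟ ⟦ + 4 ⟧) ≡ ⟦ - + 3 ⟧
    disc z z≢0 = trans (cong (λ m → m ⊠ (m ⊟ ⟦ + 4 ⟧)) (prod z z≢0))
      (solve 0 (con (+ 1) :* (con (+ 1) :- con (+ 4)) := con (- + 3)) refl)

  -- Summing over k drops the condition on the inverses and leaves the triples with sum 1.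
  ∑-n : ∑ n ≡ (+ q) ^ 2 - ((+ q) ^ 1 - ((+ q) ^ 0 - + 0))
  ∑-n = begin
    ∑ (λ k → tuples 3 λ s t → δ s 1# * δ t k)      ≡⟨ tuples-∑ 3 (λ k s t → δ s 1# * δ t k) ⟨
    tuples 3 (λ s t → ∑ λ k → δ s 1# * δ t k)      ≡⟨ tuples-cong 3 (λ s t → trans (∑-*ˡ (δ s 1#) (δ t))
      (trans (cong (δ s 1# *_) (trans (∑-cong λ k → δ-sym t k) (∑-δ1 t))) (ℤ.*-identityʳ (δ s 1#)))) ⟩
    tuples 3 (λ s _ → δ s 1#)                      ≡⟨ step 2 (step 1 (step 0 (δ-no λ eq → 1≢0 (sym eq)))) ⟩
    (+ q) ^ 2 - ((+ q) ^ 1 - ((+ q) ^ 0 - + 0))    ∎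
    where
    open ≡-Reasoning
    step : ∀ j {x} → tuples j (λ s _ → δ s 1#) ≡ x → tuples (suc j) (λ s _ → δ s 1#) ≡ (+ q) ^ j - x
    step j refl = tuples-δ-suc j 1#

  clear : ∀ k z → z ≢ 0# → z ⊠ (k ⊟ z ⁻¹) ≡ k ⊠ z ⊟ 1#
  clear k z z≢0 = trans (solve 3 (λ k z i → z :* (k :- i) := k :* z :- z :* i) refl k z (z ⁻¹))
    (cong (k ⊠ z ⊟_) (⁻¹-inverseʳ z≢0))

  -- This is z² times the discriminant ab(ab - 4) for a = 1 - z and b = k - z⁻¹; the square factor
  -- clears the denominators.
  quartic : F → F → F
  quartic k z = (1# ⊟ z) ⊠ (k ⊠ z ⊟ 1#) ⊠ ((1# ⊟ z) ⊠ (k ⊠ z ⊟ 1#) ⊟ ⟦ + 4 ⟧ ⊠ z)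

  count-2-quartic : ∀ k z → z ≢ 0# → 1# ⊟ z ≢ 0# → k ⊟ z ⁻¹ ≢ 0# →
                    count 2 (1# ⊟ z) (k ⊟ z ⁻¹) ≡ roots (quartic k z)
  count-2-quartic k z z≢0 a≢0 b≢0 = trans (count-2-nonzero a≢0 b≢0)
    (trans (sym (roots-scale z (a ⊠ b ⊠ (a ⊠ b ⊟ ⟦ + 4 ⟧)) z≢0)) (cong roots (begin
      z ⊠ z ⊠ (a ⊠ b ⊠ (a ⊠ b ⊟ ⟦ + 4 ⟧))
        ≡⟨ solve 3 (λ a b z → z :* z :* (a :* b :* (a :* b :- con (+ 4)))
             := a :* (z :* b) :* (a :* (z :* b) :- con (+ 4) :* z)) refl a b z ⟩
      a ⊠ (z ⊠ b) ⊠ (a ⊠ (z ⊠ b) ⊟ ⟦ + 4 ⟧ ⊠ z)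
        ≡⟨ cong (λ c → a ⊠ c ⊠ (a ⊠ c ⊟ ⟦ + 4 ⟧ ⊠ z)) (clear k z z≢0) ⟩
      quartic k z ∎)))
    where
    open ≡-Reasoning
    a b : F
    a = 1# ⊟ z
    b = k ⊟ z ⁻¹

  -- For t = (kz - 1)/(1 - z) one has t + 1 = (k - 1)z/(1 - z) and t + k = (k - 1)/(1 - z). In these
  -- terms the quartic is this cubic times the square of (1 - z)/(t + k).
  cubic : F → F → F
  cubic k t = t ⊠ ((k ⊟ 1#) ⊠ (k ⊟ 1#) ⊠ t ⊟ ⟦ + 4 ⟧ ⊠ (t ⊞ 1#) ⊠ (t ⊞ k))

  -- The substitution t = (k z - 1)/(1 - z) sends a root of the quartic to infinity.
  n-cubic : ∀ k → k ≢ 1# → n k ≡ ∑ λ t → ν t * (ν (t ⊞ 1#) * (ν (t ⊞ k) * roots (cubic k t)))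
  n-cubic k k≢1 = begin
    n k
      ≡⟨ count-suc 2 1# k ⟩
    ∑* (λ z → count 2 (1# ⊟ z) (k ⊟ z ⁻¹))
      ≡⟨ ∑*-cong (λ z z≢0 → simplify z z≢0 ((1# ⊟ z) ≟ 0#) ((k ⊟ z ⁻¹) ≟ 0#)) ⟩
    -- The substitution is composed of permutations of the whole field: v = 1 - z, w = v⁻¹ and t =
    -- (k - 1)w - k. At the exceptional point w = 0, that is z = 1 and t = -k, both summands have
    -- weight 0.
    ∑ f
      ≡⟨ ∑-reflect 1# f ⟨
    ∑ (λ v → f (1# ⊟ v))
      ≡⟨ ∑-⁻¹ (λ v → f (1# ⊟ v)) ⟨
    ∑ (λ w → f (1# ⊟ w ⁻¹))
      ≡⟨ ∑-cong (λ w → substitute w (w ≟ 0#)) ⟩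
    ∑ (λ w → g ((k ⊟ 1#) ⊠ w ⊞ neg k))
      ≡⟨ ∑-scale k-1≢0 (λ w → g (w ⊞ neg k)) ⟩
    ∑ (λ w → g (w ⊞ neg k))
      ≡⟨ ∑-shift (neg k) g ⟩
    ∑ g ∎
    where
    open ≡-Reasoning
    f g : F → ℤ
    f z = ν z * (ν (1# ⊟ z) * (ν (k ⊠ z ⊟ 1#) * roots (quartic k z)))
    g t = ν t * (ν (t ⊞ 1#) * (ν (t ⊞ k) * roots (cubic k t)))
    k-1≢0 : k ⊟ 1# ≢ 0#
    k-1≢0 eq = k≢1 (⊟≡0⇒≡ eq)

    simplify : ∀ z → z ≢ 0# → Dec (1# ⊟ z ≡ 0#) → Dec (k ⊟ z ⁻¹ ≡ 0#) →
               count 2 (1# ⊟ z) (k ⊟ z ⁻¹) ≡ ν (1# ⊟ z) * (ν (k ⊠ z ⊟ 1#) * roots (quartic k z))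
    -- Both vanish only for z = 1 and k = 1, the one case in which the pair count jumps to q.
    simplify z z≢0 (yes a≡0) (yes b≡0) = contradiction (trans (⊟≡0⇒≡ b≡0)
      (sym (⁻¹-unique (trans (⊠-identityʳ z) (sym (⊟≡0⇒≡ a≡0)))))) k≢1
    simplify z z≢0 (yes a≡0) (no b≢0) = trans (count-2-0ˡ a≡0 b≢0)
      (sym (cong (_* (ν (k ⊠ z ⊟ 1#) * roots (quartic k z))) (ν-0 a≡0)))
    simplify z z≢0 (no a≢0) (yes b≡0) = trans (count-2-0ʳ a≢0 b≡0)
      (sym (trans (cong (λ d → ν (1# ⊟ z) * (d * roots (quartic k z)))
        (ν-0 (trans (sym (clear k z z≢0)) (trans (cong (z ⊠_) b≡0) (⊠-zeroʳ z))))) (ℤ.*-zeroʳ (ν (1# ⊟ z)))))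
    simplify z z≢0 (no a≢0) (no b≢0) = trans (count-2-quartic k z z≢0 a≢0 b≢0)
      (sym (trans (cong₂ (λ d e → d * (e * roots (quartic k z))) (ν-1 a≢0)
          (ν-1 λ eq → ⊠-≢0 z≢0 b≢0 (trans (clear k z z≢0) eq)))
        (trans (ℤ.*-identityˡ (+ 1 * roots (quartic k z))) (ℤ.*-identityˡ (roots (quartic k z))))))

    ν-scale : ∀ {c x y} → c ≢ 0# → c ⊠ x ≡ y → ν x ≡ ν y
    ν-scale {c} c≢0 eq = ν-⇔ (λ x≡0 → trans (sym eq) (trans (cong (c ⊠_) x≡0) (⊠-zeroʳ c)))
      (λ y≡0 → ⊠-cancelˡ c≢0 (trans eq (trans y≡0 (sym (⊠-zeroʳ c)))))

    substitute : ∀ w → Dec (w ≡ 0#) → f (1# ⊟ w ⁻¹) ≡ g ((k ⊟ 1#) ⊠ w ⊞ neg k)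
    substitute w (yes w≡0) = trans
      (trans (cong (λ d → ν z * (d * (ν (k ⊠ z ⊟ 1#) * roots (quartic k z))))
          (ν-0 (trans (double (w ⁻¹)) (trans (cong _⁻¹ w≡0) ⁻¹-0))))
        (ℤ.*-zeroʳ (ν z)))
      (sym (trans (cong (λ d → ν t * (ν (t ⊞ 1#) * (d * roots (cubic k t)))) (ν-0 t+k≡0))
          (lem (ν t) (ν (t ⊞ 1#)))))
      where
      z t : F
      z = 1# ⊟ w ⁻¹
      t = (k ⊟ 1#) ⊠ w ⊞ neg k
      double : ∀ v → 1# ⊟ (1# ⊟ v) ≡ v
      double = solve 1 (λ v → con (+ 1) :- (con (+ 1) :- v) := v) refl
      t+k≡0 : t ⊞ k ≡ 0#
      t+k≡0 = trans (cong (λ w → (k ⊟ 1#) ⊠ w ⊞ neg k ⊞ k) w≡0)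
        (solve 1 (λ k → (k :- con (+ 1)) :* con (+ 0) :+ (:- k) :+ k := con (+ 0)) refl k)
      lem : ∀ a b → a * (b * (+ 0)) ≡ + 0
      lem = solve-∀
    substitute w (no w≢0) = trans
      (cong₂ (λ a b → a * (b * (ν (k ⊠ z ⊟ 1#) * roots (quartic k z))))
        (ν-scale (⊠-≢0 k-1≢0 w≢0) z-eq) (ν-scale (⊠-≢0 k-1≢0 (⊠-≢0 w≢0 w≢0)) a-eq))
      (trans (cong₂ (λ c r → ν (t ⊞ 1#) * (ν (t ⊞ k) * (c * r))) (ν-scale w≢0 c-eq)
          (trans (sym (roots-scale c (quartic k z) c≢0)) (cong roots quartic-eq)))
        (lem (ν (t ⊞ 1#)) (ν (t ⊞ k)) (ν t) (roots (cubic k t))))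
      where
      v z t c : F
      v = w ⁻¹
      z = 1# ⊟ v
      t = (k ⊟ 1#) ⊠ w ⊞ neg k
      c = (k ⊟ 1#) ⊠ (w ⊠ w)
      c≢0 : c ≢ 0#
      c≢0 = ⊠-≢0 k-1≢0 (⊠-≢0 w≢0 w≢0)
      lem : ∀ a b c d → a * (b * (c * d)) ≡ c * (a * (b * d))
      lem = solve-∀
      wv≡1 : w ⊠ v ≡ 1#
      wv≡1 = ⁻¹-inverseʳ w≢0
      z-eq : (k ⊟ 1#) ⊠ w ⊠ z ≡ t ⊞ 1#
      z-eq = trans (solve 3 (λ k w v → (k :- con (+ 1)) :* w :* (con (+ 1) :- v) := (k :- con (+ 1)) :*
          (w :- w :* v)) refl k w v)
        (trans (cong (λ e → (k ⊟ 1#) ⊠ (w ⊟ e)) wv≡1)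
          (solve 2 (λ k w → (k :- con (+ 1)) :* (w :- con (+ 1)) := (k :- con (+ 1)) :* w :+ (:- k) :+ con
              (+ 1)) refl k w))
      a-eq : (k ⊟ 1#) ⊠ (w ⊠ w) ⊠ (1# ⊟ z) ≡ t ⊞ k
      a-eq = trans (solve 3 (λ k w v → (k :- con (+ 1)) :* (w :* w) :* (con (+ 1) :- (con (+ 1) :- v))
          := (k :- con (+ 1)) :* w :* (w :* v)) refl k w v)
        (trans (cong (λ e → (k ⊟ 1#) ⊠ w ⊠ e) wv≡1)
          (solve 2 (λ k w → (k :- con (+ 1)) :* w :* con (+ 1) := (k :- con (+ 1)) :* w :+ (:- k) :+ k) refl k
              w))
      c-eq : w ⊠ (k ⊠ z ⊟ 1#) ≡ t
      c-eq = trans (solve 3 (λ k w v → w :* (k :* (con (+ 1) :- v) :- con (+ 1)) := w :* (k :- con (+ 1)) :- k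
          :* (w :* v)) refl k w v)
        (trans (cong (λ e → w ⊠ (k ⊟ 1#) ⊟ k ⊠ e) wv≡1)
          (solve 2 (λ k w → w :* (k :- con (+ 1)) :- k :* con (+ 1) := (k :- con (+ 1)) :* w :+ (:- k)) refl k
              w))
      quartic-eq : c ⊠ c ⊠ quartic k z ≡ cubic k t
      quartic-eq = begin
        c ⊠ c ⊠ quartic k z
          ≡⟨ solve 3 (λ k w z → let a = con (+ 1) :- z ; b = k :* z :- con (+ 1) ; l = k :- con (+ 1) in
                l :* (w :* w) :* (l :* (w :* w)) :* (a :* b :* (a :* b :- con (+ 4) :* z))
                := (w :* a) :* (w :* b) :* (l :* l :* ((w :* a) :* (w :* b)) :- con (+ 4) :* (l :* w :* z) :*
                    (l :* w))) refl k w z ⟩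
        (w ⊠ (1# ⊟ z)) ⊠ (w ⊠ (k ⊠ z ⊟ 1#)) ⊠ ((k ⊟ 1#) ⊠ (k ⊟ 1#) ⊠ ((w ⊠ (1# ⊟ z)) ⊠ (w ⊠ (k ⊠ z ⊟ 1#)))
            ⊟ ⟦ + 4 ⟧ ⊠ ((k ⊟ 1#) ⊠ w ⊠ z) ⊠ ((k ⊟ 1#) ⊠ w))
          ≡⟨ cong₂ (λ x y → x ⊠ y ⊠ ((k ⊟ 1#) ⊠ (k ⊟ 1#) ⊠ (x ⊠ y) ⊟ ⟦ + 4 ⟧ ⊠ ((k ⊟ 1#) ⊠ w ⊠ z) ⊠
              ((k ⊟ 1#) ⊠ w)))
               (trans (cong (w ⊠_) (solve 1 (λ v → con (+ 1) :- (con (+ 1) :- v) := v) refl v)) wv≡1) c-eq ⟩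
        1# ⊠ t ⊠ ((k ⊟ 1#) ⊠ (k ⊟ 1#) ⊠ (1# ⊠ t) ⊟ ⟦ + 4 ⟧ ⊠ ((k ⊟ 1#) ⊠ w ⊠ z) ⊠ ((k ⊟ 1#) ⊠ w))
          ≡⟨ cong₂ (λ x y → 1# ⊠ t ⊠ ((k ⊟ 1#) ⊠ (k ⊟ 1#) ⊠ (1# ⊠ t) ⊟ ⟦ + 4 ⟧ ⊠ x ⊠ y)) z-eq
               (solve 2 (λ k w → (k :- con (+ 1)) :* w := (k :- con (+ 1)) :* w :+ (:- k) :+ k) refl k w) ⟩
        1# ⊠ t ⊠ ((k ⊟ 1#) ⊠ (k ⊟ 1#) ⊠ (1# ⊠ t) ⊟ ⟦ + 4 ⟧ ⊠ (t ⊞ 1#) ⊠ (t ⊞ k))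
          ≡⟨ cong (λ x → x ⊠ ((k ⊟ 1#) ⊠ (k ⊟ 1#) ⊠ x ⊟ ⟦ + 4 ⟧ ⊠ (t ⊞ 1#) ⊠ (t ⊞ k))) (⊠-identityˡ t) ⟩
        cubic k t ∎

  ∑-ν-⊞ : ∀ c (f : F → ℤ) → ∑ (λ t → ν (t ⊞ c) * f t) ≡ ∑ f - f (neg c)
  ∑-ν-⊞ c f = begin
    ∑ (λ t → ν (t ⊞ c) * f t)
      ≡⟨ ∑-cong (λ t → cong (λ u → ν (t ⊞ c) * f u) (solve 2 (λ t c → t := t :+ c :- c) refl t c)) ⟩
    ∑ (λ t → ν (t ⊞ c) * f (t ⊞ c ⊟ c))
      ≡⟨ ∑-shift c (λ t → ν t * f (t ⊟ c)) ⟩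
    ∑ (λ t → ν t * f (t ⊟ c))
      ≡⟨ ∑-ν (λ t → f (t ⊟ c)) ⟩
    ∑ (λ t → f (t ⊞ neg c)) - f (0# ⊟ c)
      ≡⟨ cong₂ _-_ (∑-shift (neg c) f) (cong f (⊞-identityˡ (neg c))) ⟩
    ∑ f - f (neg c) ∎
    where open ≡-Reasoning

  -- The excluded t = 0, -1, -k carry 1, 2 and 2 points, since the cubic takes there the values 0,
  -- (k - 1)² and (k(k - 1))². With the point at infinity these are the six points by which |E_k|
  -- exceeds n(k).
  n-generic : ∀ k → k ≢ 0# → k ≢ 1# → n k ≡ ∑ (λ t → roots (cubic k t)) - + 5
  n-generic k k≢0 k≢1 = begin
    n k
      ≡⟨ n-cubic k k≢1 ⟩
    ∑ (λ t → ν t * A t)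
      ≡⟨ ∑-ν A ⟩
    ∑ A - A 0#
      ≡⟨ cong₂ _-_ (trans (∑-ν-⊞ 1# B) (cong₂ _-_ (∑-ν-⊞ k r) B-1)) A0 ⟩
    ∑ r - r (neg k) - + 2 - + 1
      ≡⟨ cong (λ x → ∑ r - x - + 2 - + 1) r-k ⟩
    ∑ r - + 2 - + 2 - + 1
      ≡⟨ lem (∑ r) ⟩
    ∑ r - + 5 ∎
    where
    open ≡-Reasoning
    r A B : F → ℤ
    r t = roots (cubic k t)
    B t = ν (t ⊞ k) * r t
    A t = ν (t ⊞ 1#) * B t
    lem : ∀ x → x - + 2 - + 2 - + 1 ≡ x - + 5
    lem = solve-∀
    k-1≢0 : k ⊟ 1# ≢ 0#
    k-1≢0 eq = k≢1 (⊟≡0⇒≡ eq)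
    r-k : r (neg k) ≡ + 2
    r-k = roots-square (k ⊠ (k ⊟ 1#))
        (solve 1 (λ k → (:- k) :* ((k :- con (+ 1)) :* (k :- con (+ 1)) :* (:- k) :- con (+ 4) :*
        ((:- k) :+ con (+ 1)) :* ((:- k) :+ k))
      := k :* (k :- con (+ 1)) :* (k :* (k :- con (+ 1)))) refl k) (⊠-≢0 k≢0 k-1≢0)
    r-1 : r (neg 1#) ≡ + 2
    r-1 = roots-square (k ⊟ 1#) (solve 1
        (λ k → (:- con (+ 1)) :* ((k :- con (+ 1)) :* (k :- con (+ 1)) :* (:- con (+ 1)) :- con (+ 4) :*
        ((:- con (+ 1)) :+ con (+ 1)) :* ((:- con (+ 1)) :+ k))
      := (k :- con (+ 1)) :* (k :- con (+ 1))) refl k) k-1≢0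
    B-1 : B (neg 1#) ≡ + 2
    B-1 = cong₂ _*_ (ν-1 {neg 1# ⊞ k} λ eq → k-1≢0 (trans (⊞-comm k (neg 1#)) eq)) r-1
    A0 : A 0# ≡ + 1
    A0 = cong₂ _*_ (ν-1 {0# ⊞ 1#} λ eq → 1≢0 (trans (sym (⊞-identityˡ 1#)) eq))
      (cong₂ _*_ (ν-1 {0# ⊞ k} λ eq → k≢0 (trans (sym (⊞-identityˡ k)) eq)) (roots-0 (⊠-zeroˡ _)))

  -- Here the cubic is t²(-4t - 3), so a linear polynomial remains, with p points in all. The
  -- excluded t = -1 and t = 0 account for 2 and ρ of them.
  n-0 : n 0# ≡ + p - + 2 - ρ
  n-0 = begin
    n 0#
      ≡⟨ n-cubic 0# (λ eq → 1≢0 (sym eq)) ⟩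
    ∑* (λ t → ν (t ⊞ 1#) * (ν (t ⊞ 0#) * roots (cubic 0# t)))
      ≡⟨ ∑*-cong (λ t t≢0 → cong (ν (t ⊞ 1#) *_)
          (trans (cong (_* roots (cubic 0# t))
          (ν-1 {t ⊞ 0#} λ eq → t≢0 (trans (solve 1 (λ t → t := t :+ con (+ 0)) refl t) eq)))
           (trans (ℤ.*-identityˡ (roots (cubic 0# t)))
               (trans (cong roots (factor t)) (roots-scale t (linear t) t≢0))))) ⟩
    ∑* A
      ≡⟨ ∑-ν A ⟩
    ∑ A - A 0#
      ≡⟨ cong₂ _-_ (trans (∑-ν-⊞ 1# (λ t → roots (linear t))) (cong₂ _-_ (∑-roots-affine ⟦ - + 3 ⟧ -4≢0) r-1))
          A0 ⟩
    + p - + 2 - ρ ∎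
    where
    open ≡-Reasoning
    linear : F → F
    linear t = neg ⟦ + 4 ⟧ ⊠ t ⊞ ⟦ - + 3 ⟧
    A : F → ℤ
    A t = ν (t ⊞ 1#) * roots (linear t)
    -4≢0 : neg ⟦ + 4 ⟧ ≢ 0#
    -4≢0 = neg-≢0 4≢0
    factor : ∀ t → cubic 0# t ≡ t ⊠ t ⊠ linear t
    factor = solve 1 (λ t → t :* ((con (+ 0) :- con (+ 1)) :* (con (+ 0) :- con (+ 1)) :* t :- con (+ 4) :*
        (t :+ con (+ 1)) :* (t :+ con (+ 0)))
      := t :* t :* ((:- con (+ 4)) :* t :+ con (- + 3))) refl
    r-1 : roots (linear (neg 1#)) ≡ + 2
    r-1 = roots-square 1# (solve 0 ((:- con (+ 4)) :* (:- con (+ 1)) :+ con (- + 3) := con (+ 1) :* con (+ 1))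
        refl) 1≢0
    A0 : A 0# ≡ ρ
    A0 = trans (cong₂ _*_ (ν-1 {0# ⊞ 1#} λ eq → 1≢0 (trans (sym (⊞-identityˡ 1#)) eq))
        (cong roots (solve 0 ((:- con (+ 4)) :* con (+ 0) :+ con (- + 3) := con (- + 3)) refl)))
      (ℤ.*-identityˡ ρ)

  -- For k = 1 the quartic is the square of (1 - z)(1 + z). Each nonzero z thus gives 2, except that
  -- z = -1 gives 1 and z = 1, where both sums of the remaining pair vanish, gives q.
  n-1 : n 1# ≡ + 3 * + p - + 6
  n-1 = begin
    n 1#
      ≡⟨ count-suc 2 1# 1# ⟩
    ∑* (λ z → count 2 (1# ⊟ z) (1# ⊟ z ⁻¹))
      ≡⟨ ∑*-cong (λ z z≢0 → value z z≢0 (z ≟ 1#) (z ≟ neg 1#)) ⟩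
    ∑* (λ z → + 2 + (δ z (neg 1#) * - + 1 + δ z 1# * (+ q - + 2)))
      ≡⟨ ∑*-+ (λ _ → + 2) (λ z → δ z (neg 1#) * - + 1 + δ z 1# * (+ q - + 2)) ⟩
    ∑* (λ _ → + 2) + ∑* (λ z → δ z (neg 1#) * - + 1 + δ z 1# * (+ q - + 2))
      ≡⟨ cong₂ _+_ (∑*-const (+ 2)) (trans (∑*-+ (λ z → δ z (neg 1#) * - + 1) (λ z → δ z 1# * (+ q - + 2)))
           (cong₂ _+_ (∑*-δ -1≢0 (- + 1)) (∑*-δ 1≢0 (+ q - + 2)))) ⟩
    + q * + 2 + (- + 1 + (+ q - + 2))
      ≡⟨ lem (+ q) ⟩
    + 3 * + p - + 6 ∎
    where
    open ≡-Reasoning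
    lem : ∀ q → q * + 2 + (- + 1 + (q - + 2)) ≡ + 3 * (+ 1 + q) - + 6
    lem = solve-∀
    -1≢0 : neg 1# ≢ 0#
    -1≢0 = neg-≢0 1≢0
    ∑*-δ : ∀ {a} → a ≢ 0# → ∀ c → ∑* (λ z → δ z a * c) ≡ c
    ∑*-δ {a} a≢0 c = trans (∑-cong λ z → swap (ν z) (δ z a) c) (trans (∑-δ a (λ z → ν z * c))
      (trans (cong (_* c) (ν-1 a≢0)) (ℤ.*-identityˡ c)))
      where
      swap : ∀ a b c → a * (b * c) ≡ b * (a * c)
      swap = solve-∀
    -1≢1 : neg 1# ≢ 1#
    -1≢1 eq = 2≢0 (trans (solve 0 (con (+ 2) := con (+ 1) :- (:- con (+ 1))) refl) (≡⇒⊟≡0 (sym eq)))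
    value : ∀ z → z ≢ 0# → Dec (z ≡ 1#) → Dec (z ≡ neg 1#) → count 2 (1# ⊟ z) (1# ⊟ z ⁻¹)
            ≡ + 2 + (δ z (neg 1#) * - + 1 + δ z 1# * (+ q - + 2))
    value z z≢0 (yes z≡1) (yes z≡-1) = contradiction (trans (sym z≡-1) z≡1) -1≢1
    value z z≢0 (yes z≡1) (no z≢-1) = trans
      (count-2-00 (≡⇒⊟≡0 (sym z≡1)) (≡⇒⊟≡0 (⁻¹-unique (trans (⊠-identityʳ z) z≡1))))
      (sym (trans (cong₂ (λ d e → + 2 + (d * - + 1 + e * (+ q - + 2))) (δ-no z≢-1) (δ-yes z≡1))
          (collect (+ q))))
      where
      collect : ∀ q → + 2 + (+ 0 * - + 1 + + 1 * (q - + 2)) ≡ q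
      collect = solve-∀
    value z z≢0 (no z≢1) z≟-1 = trans (count-2-quartic 1# z z≢0 a≢0 b≢0)
        (trans (cong roots square) (by-cases z≟-1))
      where
      a≢0 : 1# ⊟ z ≢ 0#
      a≢0 eq = z≢1 (sym (⊟≡0⇒≡ eq))
      b≢0 : 1# ⊟ z ⁻¹ ≢ 0#
      b≢0 eq = z≢1 (trans (sym (⊠-identityʳ z)) (trans (cong (z ⊠_) (⊟≡0⇒≡ eq)) (⁻¹-inverseʳ z≢0)))
      square : quartic 1# z ≡ (1# ⊟ z) ⊠ (z ⊞ 1#) ⊠ ((1# ⊟ z) ⊠ (z ⊞ 1#))
      square = solve 1 (λ z → (con (+ 1) :- z) :* (con (+ 1) :* z :- con (+ 1)) :*
          ((con (+ 1) :- z) :* (con (+ 1) :* z :- con (+ 1)) :- con (+ 4) :* z)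
        := (con (+ 1) :- z) :* (z :+ con (+ 1)) :* ((con (+ 1) :- z) :* (z :+ con (+ 1)))) refl z
      tail : ∀ d → + 2 + (d * - + 1 + δ z 1# * (+ q - + 2)) ≡ + 2 + (d * - + 1 + + 0)
      tail d = cong (λ e → + 2 + (d * - + 1 + e * (+ q - + 2))) (δ-no z≢1)
      by-cases : Dec (z ≡ neg 1#) → roots ((1# ⊟ z) ⊠ (z ⊞ 1#) ⊠ ((1# ⊟ z) ⊠ (z ⊞ 1#)))
                 ≡ + 2 + (δ z (neg 1#) * - + 1 + δ z 1# * (+ q - + 2))
      by-cases (yes z≡-1) = trans
        (roots-0 (trans (cong (λ y → (1# ⊟ z) ⊠ y ⊠ ((1# ⊟ z) ⊠ y)) z+1≡0)
            (solve 1 (λ x → x :* con (+ 0) :* (x :* con (+ 0)) := con (+ 0)) refl (1# ⊟ z))))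
        (sym (trans (cong (λ d → + 2 + (d * - + 1 + δ z 1# * (+ q - + 2))) (δ-yes z≡-1)) (tail (+ 1))))
        where
        z+1≡0 : z ⊞ 1# ≡ 0#
        z+1≡0 = trans (cong (_⊞ 1#) z≡-1) (⊞-inverseˡ 1#)
      by-cases (no z≢-1) = trans
        (roots-square ((1# ⊟ z) ⊠ (z ⊞ 1#)) refl
            (⊠-≢0 a≢0 λ eq → z≢-1 (trans (solve 1 (λ z → z := z :+ con (+ 1) :- con (+ 1)) refl z)
            (trans (cong (_⊟ 1#) eq) (⊞-identityˡ (neg 1#))))))
        (sym (trans (cong (λ d → + 2 + (d * - + 1 + δ z 1# * (+ q - + 2))) (δ-no z≢-1)) (tail (+ 0))))

  9≢0 : ⟦ + 9 ⟧ ≢ 0#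
  9≢0 eq = ⊠-≢0 3≢0 3≢0 (trans (solve 0 (con (+ 3) :* con (+ 3) := con (+ 9)) refl) eq)

  9≢1 : ⟦ + 9 ⟧ ≢ 1#
  9≢1 eq = ⊠-≢0 2≢0 4≢0 (trans (solve 0 (con (+ 2) :* con (+ 4) := con (+ 9) :- con (+ 1)) refl) (≡⇒⊟≡0 eq))

  -- For k = 9 the cubic degenerates to -4t(t - 3)². Outside t = 3 the square factor drops out and
  -- -t remains; at t = 3 the value ρ of the simplified count is replaced by 1.
  n-9 : n ⟦ + 9 ⟧ ≡ + p - + 4 - ρ
  n-9 = begin
    n ⟦ + 9 ⟧
      ≡⟨ n-generic ⟦ + 9 ⟧ 9≢0 9≢1 ⟩
    ∑ (λ t → roots (cubic ⟦ + 9 ⟧ t)) - + 5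
      ≡⟨ cong (_- + 5) (∑-cong λ t → value t (t ≟ ⟦ + 3 ⟧)) ⟩
    ∑ (λ t → roots (affine t) + δ t ⟦ + 3 ⟧ * (+ 1 - roots (affine t))) - + 5
      ≡⟨ cong (_- + 5) (trans (∑-+ (λ t → roots (affine t)) (λ t → δ t ⟦ + 3 ⟧ * (+ 1 - roots (affine t))))
           (cong₂ _+_ (∑-roots-affine 0# (neg-≢0 1≢0)) (∑-δ ⟦ + 3 ⟧ (λ t → + 1 - roots (affine t))))) ⟩
    + p + (+ 1 - roots (affine ⟦ + 3 ⟧)) - + 5
      ≡⟨ cong (λ D → + p + (+ 1 - roots D) - + 5)
          (solve 0 ((:- con (+ 1)) :* con (+ 3) :+ con (+ 0) := con (- + 3)) refl) ⟩
    + p + (+ 1 - ρ) - + 5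
      ≡⟨ lem (+ p) ρ ⟩
    + p - + 4 - ρ ∎
    where
    open ≡-Reasoning
    lem : ∀ p r → p + (+ 1 - r) - + 5 ≡ p - + 4 - r
    lem = solve-∀
    affine : F → F
    affine t = neg 1# ⊠ t ⊞ 0#
    factor : ∀ t → cubic ⟦ + 9 ⟧ t ≡ ⟦ + 2 ⟧ ⊠ (t ⊟ ⟦ + 3 ⟧) ⊠ (⟦ + 2 ⟧ ⊠ (t ⊟ ⟦ + 3 ⟧)) ⊠ affine t
    factor = solve 1 (λ t → t :* ((con (+ 9) :- con (+ 1)) :* (con (+ 9) :- con (+ 1)) :* t :- con (+ 4) :*
        (t :+ con (+ 1)) :* (t :+ con (+ 9)))
      := con (+ 2) :* (t :- con (+ 3)) :* (con (+ 2) :* (t :- con (+ 3))) :* ((:- con (+ 1)) :* t :+ con (+ 0)))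
          refl
    value : ∀ t → Dec (t ≡ ⟦ + 3 ⟧) → roots (cubic ⟦ + 9 ⟧ t) ≡ roots (affine t) + δ t ⟦ + 3 ⟧ *
        (+ 1 - roots (affine t))
    value t (yes t≡3) = trans (roots-0
        (trans (factor t) (trans (cong (λ e → ⟦ + 2 ⟧ ⊠ e ⊠ (⟦ + 2 ⟧ ⊠ e) ⊠ affine t) (≡⇒⊟≡0 t≡3))
        (solve 1 (λ x → con (+ 2) :* con (+ 0) :* (con (+ 2) :* con (+ 0)) :* x := con (+ 0)) refl
            (affine t)))))
      (sym (trans (cong (λ d → roots (affine t) + d * (+ 1 - roots (affine t))) (δ-yes t≡3))
          (one (roots (affine t)))))
      where
      one : ∀ r → r + + 1 * (+ 1 - r) ≡ + 1
      one = solve-∀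
    value t (no t≢3) = trans (trans (cong roots (factor t)) (roots-scale (⟦ + 2 ⟧ ⊠ (t ⊟ ⟦ + 3 ⟧)) (affine t)
        (⊠-≢0 2≢0 λ eq → t≢3 (⊟≡0⇒≡ eq))))
      (sym (trans (cong (λ d → roots (affine t) + d * (+ 1 - roots (affine t))) (δ-no t≢3))
          (ℤ.+-identityʳ (roots (affine t)))))

  curve : F → F → F
  curve k x = ⟦ + 4 ⟧ ⊠ k ⊠ x ⊠ x ⊠ x ⊞ (k ⊠ k ⊟ ⟦ + 6 ⟧ ⊠ k ⊟ ⟦ + 3 ⟧) ⊠ x ⊠ x ⊞ ⟦ + 4 ⟧ ⊠ x

  -- The two models of the curve are related by t = -kx, up to the factor k².
  ∑-cubic : ∀ k → k ≢ 0# → ∑ (λ t → roots (cubic k t)) ≡ ∑ (λ x → roots (curve k x))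
  ∑-cubic k k≢0 = trans (sym (∑-scale (neg-≢0 k≢0) (λ t → roots (cubic k t))))
    (∑-cong λ x → trans (cong roots (factor x)) (roots-scale k (curve k x) k≢0))
    where
    factor : ∀ x → cubic k (neg k ⊠ x) ≡ k ⊠ k ⊠ curve k x
    factor x = solve 2 (λ k x → (:- k) :* x :* ((k :- con (+ 1)) :* (k :- con (+ 1)) :* ((:- k) :* x) :- con
        (+ 4) :* ((:- k) :* x :+ con (+ 1)) :* ((:- k) :* x :+ k))
      := k :* k :* (con (+ 4) :* k :* x :* x :* x :+ (k :* k :- con (+ 6) :* k :- con (+ 3)) :* x :* x :+ con
          (+ 4) :* x)) refl k x

  -- Translation of the cyclotomic statement

  if-== : ∀ {m n} {x y : F} → (m ≡ n → x ≡ y) → (x ≡ y → m ≡ n) → ∀ a →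
          (if m == n then a else + 0) ≡ δ x y * a
  if-== {m} {n} to from a with m ℕ.≟ n
  ... | yes eq = sym (trans (cong (_* a) (δ-yes (to eq))) (ℤ.*-identityˡ a))
  ... | no neq = sym (cong (_* a) (δ-no (neq ∘ from)))

  constGR-δ : ∀ a y → constGR p a (toℕ y) ≡ δ y 0# * a
  constGR-δ a y = if-== (λ eq → Fin.toℕ-injective (trans eq (sym toℕ-0#))) (λ { refl → toℕ-0# }) a

  e-δ : ∀ t y → e p t (toℕ y) ≡ δ y ⟦ + t ⟧
  e-δ t y = trans (if-== (λ eq → Fin.toℕ-injective (trans eq (sym (⟦⟧-+-toℕ t))))
    (λ eq → trans (cong toℕ eq) (⟦⟧-+-toℕ t)) (+ 1)) (ℤ.*-identityʳ (δ y ⟦ + t ⟧))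

  sumFromTo-∑* : ∀ (f : ℕ → ℤ) → sumFromTo 1 q f ≡ ∑* (f ∘ toℕ)
  sumFromTo-∑* f = trans (sumFromTo-1 q f)
    (trans (cong₂ _-_ (∑-sumℕ f) (cong f (sym toℕ-0#))) (sym (∑-ν (f ∘ toℕ))))

  toℕ-⊟ : ∀ y a → toℕ (y ⊟ a) ≡ (toℕ y ℕ.+ (p ∸ toℕ a)) ℕ.% p
  toℕ-⊟ y a = trans (cong toℕ (trans (cong₂ _⊟_ (sym (⟦⟧-toℤ y)) (sym (⟦⟧-toℤ a)))
      (trans (cong (⟦ toℤ y ⟧ ⊞_) (sym (⟦⟧-neg (toℤ a)))) (trans (sym (⟦⟧-+ (toℤ y) (- toℤ a)))
        (∣⇒⟦⟧≡ (divides (- + 1) (trans (cong (λ z → toℤ y - toℤ a - (toℤ y + z)) p∸a)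
            (lem (toℤ y) (toℤ a) (+ p)))))))))
    (⟦⟧-+-toℕ (toℕ y ℕ.+ (p ∸ toℕ a)))
    where
    p∸a : + (p ∸ toℕ a) ≡ + p - toℤ a
    p∸a = trans (sym (ℤ.⊖-≥ (ℕ.<⇒≤ (Fin.toℕ<n a)))) (sym (ℤ.m-n≡m⊖n p (toℕ a)))
    lem : ∀ y a p → y - a - (y + (p - a)) ≡ - + 1 * p
    lem = solve-∀

  mul-∑ : ∀ f g y → mul p f g (toℕ y) ≡ ∑ λ a → f (toℕ a) * g (toℕ (y ⊟ a))
  mul-∑ f g y = trans (∑-sumℕ λ a → f a * g (modN p (toℕ y ℕ.+ (p ∸ a))))
    (∑-cong λ a → cong (λ m → f (toℕ a) * g m) (sym (toℕ-⊟ y a)))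

  K-∑* : ∀ u a → K p (toℕ u) (toℕ a) ≡ ∑* λ x → δ a (x ⊞ u ⊠ x ⁻¹)
  K-∑* u a = trans (sumFromTo-∑* λ x → e p (x ℕ.+ toℕ u ℕ.* inv p x) (toℕ a))
    (∑*-cong′ λ x → trans (e-δ (toℕ x ℕ.+ toℕ u ℕ.* inv p (toℕ x)) a) (cong (δ a) (begin
      ⟦ + (toℕ x ℕ.+ toℕ u ℕ.* inv p (toℕ x)) ⟧
        ≡⟨ cong ⟦_⟧ (trans (ℤ.pos-+ (toℕ x) _) (cong (_+_ (toℤ x)) (ℤ.pos-* (toℕ u) (inv p (toℕ x))))) ⟩
      ⟦ toℤ x + toℤ u * + inv p (toℕ x) ⟧
        ≡⟨ trans (⟦⟧-+ (toℤ x) _) (cong (⟦ toℤ x ⟧ ⊞_) (⟦⟧-* (toℤ u) (+ inv p (toℕ x)))) ⟩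
      ⟦ toℤ x ⟧ ⊞ ⟦ toℤ u ⟧ ⊠ ⟦ + inv p (toℕ x) ⟧
        ≡⟨ cong₂ _⊞_ (⟦⟧-toℤ x) (cong₂ _⊠_ (⟦⟧-toℤ u) (sym (⁻¹-def x))) ⟩
      x ⊞ u ⊠ x ⁻¹ ∎)))
    where open ≡-Reasoning

  -- When the power is expanded, each factor contributes an exponent x + ux⁻¹, and these exponents
  -- add up to s + us′.
  pow-tuples : ∀ j u y → pow p (K p (toℕ u)) j (toℕ y) ≡ tuples j λ s s′ → δ y (s ⊞ u ⊠ s′)
  pow-tuples zero u y = trans (constGR-δ (+ 1) y) (trans (ℤ.*-identityʳ (δ y 0#))
    (cong (δ y) (solve 1 (λ u → con (+ 0) := con (+ 0) :+ u :* con (+ 0)) refl u)))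
  pow-tuples (suc j) u y = begin
    mul p (K p (toℕ u)) (pow p (K p (toℕ u)) j) (toℕ y)
      ≡⟨ mul-∑ (K p (toℕ u)) (pow p (K p (toℕ u)) j) y ⟩
    ∑ (λ a → K p (toℕ u) (toℕ a) * pow p (K p (toℕ u)) j (toℕ (y ⊟ a)))
      ≡⟨ ∑-cong (λ a → trans (cong₂ _*_ (K-∑* u a) (pow-tuples j u (y ⊟ a)))
           (trans (sym (∑-*ʳ (λ x → ν x * δ a (x ⊞ u ⊠ x ⁻¹)) (G a)))
             (∑-cong λ x → ℤ.*-assoc (ν x) (δ a (x ⊞ u ⊠ x ⁻¹)) (G a)))) ⟩
    ∑ (λ a → ∑* λ x → δ a (x ⊞ u ⊠ x ⁻¹) * G a)
      ≡⟨ ∑*-∑ (λ x a → δ a (x ⊞ u ⊠ x ⁻¹) * G a) ⟨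
    ∑* (λ x → ∑ λ a → δ a (x ⊞ u ⊠ x ⁻¹) * G a)
      ≡⟨ ∑*-cong′ (λ x → ∑-δ (x ⊞ u ⊠ x ⁻¹) G) ⟩
    ∑* (λ x → G (x ⊞ u ⊠ x ⁻¹))
      ≡⟨ ∑*-cong′ (λ x → tuples-cong j λ s s′ → δ-⇔
           (λ eq → trans (sym (≡⊟⇒⊞≡ (sym eq))) (regroup x s s′))
           (λ eq → sym (⊞≡⇒≡⊟ (trans (regroup x s s′) (sym eq))))) ⟩
    tuples (suc j) (λ s s′ → δ y (s ⊞ u ⊠ s′)) ∎
    where
    open ≡-Reasoning
    G : F → ℤ
    G a = tuples j λ s s′ → δ (y ⊟ a) (s ⊞ u ⊠ s′)
    regroup : ∀ x s s′ → x ⊞ u ⊠ x ⁻¹ ⊞ (s ⊞ u ⊠ s′) ≡ x ⊞ s ⊞ u ⊠ (x ⁻¹ ⊞ s′)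
    regroup x s s′ = solve 5 (λ x u i s s′ → x :+ u :* i :+ (s :+ u :* s′) := x :+ s :+ u :* (i :+ s′)) refl x u
        (x ⁻¹) s s′

  sumGR-pow : ∀ j y → sumGR 1 q (λ u → pow p (K p u) j) (toℕ y) ≡ ∑* λ u → tuples j λ s s′ → δ y (s ⊞ u ⊠ s′)
  sumGR-pow j y = trans (sumFromTo-∑* λ u → pow p (K p u) j (toℕ y))
    (∑*-cong′ {λ u → pow p (K p (toℕ u)) j (toℕ y)} λ u → pow-tuples j u y)

  V6-V : ∀ y → V6 p (toℕ y) ≡ V y
  V6-V = sumGR-pow 6

  Φ-constGR : ∀ c y → mul p Φ (constGR p c) (toℕ y) ≡ c
  Φ-constGR c y = begin
    mul p Φ (constGR p c) (toℕ y)
      ≡⟨ mul-∑ Φ (constGR p c) y ⟩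
    ∑ (λ a → + 1 * constGR p c (toℕ (y ⊟ a)))
      ≡⟨ ∑-cong (λ a → trans (ℤ.*-identityˡ (constGR p c (toℕ (y ⊟ a)))) (constGR-δ c (y ⊟ a))) ⟩
    ∑ (λ a → δ (y ⊟ a) 0# * c)
      ≡⟨ ∑-cong (λ a → cong (λ d → d * c) (δ-⇔ {y ⊟ a} {0#} {a} {y} (λ y-a≡0 → sym (⊟≡0⇒≡ y-a≡0))
          (λ a≡y → ≡⇒⊟≡0 (sym a≡y)))) ⟩
    ∑ (λ a → δ a y * c)
      ≡⟨ ∑-δ y (λ _ → c) ⟩
    c ∎
    where open ≡-Reasoning

  -- Such an f is R + cΦ, so the constant c witnesses membership in the ideal.
  ≈-constGR : ∀ (f : GR) c R → (∀ y → f (toℕ y) ≡ c + δ y 0# * R) → f ≈⟨ p ⟩ constGR p R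
  ≈-constGR f c R f-eq = constGR p c , λ t t<p → subst
    (λ t → f t - constGR p R t ≡ mul p Φ (constGR p c) t) (Fin.toℕ-fromℕ< t<p) (at (fromℕ< t<p))
    where
    cancel : ∀ a b → a + b - b ≡ a
    cancel = solve-∀
    at : ∀ y → f (toℕ y) - constGR p R (toℕ y) ≡ mul p Φ (constGR p c) (toℕ y)
    at y = trans (cong₂ _-_ (f-eq y) (constGR-δ R y)) (trans (cancel c (δ y 0# * R)) (sym (Φ-constGR c y)))

  V-δ : ∀ {R} → V 0# - V 1# ≡ R → ∀ y → V y ≡ V 1# + δ y 0# * R
  V-δ {R} eq y = by-cases (y ≟ 0#)
    where
    split : ∀ a b → a ≡ b + + 1 * (a - b)
    split = solve-∀
    by-cases : Dec (y ≡ 0#) → V y ≡ V 1# + δ y 0# * R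
    by-cases (yes y≡0) = trans (cong V y≡0) (trans (split (V 0#) (V 1#))
      (sym (cong₂ (λ d r → V 1# + d * r) (δ-yes y≡0) (sym eq))))
    by-cases (no y≢0) = trans (V-nonzero y≢0)
        (sym (trans (cong (λ d → V 1# + d * R) (δ-no y≢0)) (ℤ.+-identityʳ (V 1#))))

  V6-constant : ∀ {R} → V 0# - V 1# ≡ R → V6 p ≈⟨ p ⟩ constGR p R
  V6-constant {R} eq = ≈-constGR (V6 p) (V 1#) R λ y → trans (V6-V y) (V-δ eq y)

  -- Point counts and Frobenius traces of E_k

  hom-+ : ∀ {a b x y} → ⟦ a ⟧ ≡ x → ⟦ b ⟧ ≡ y → ⟦ a + b ⟧ ≡ x ⊞ y
  hom-+ {a} {b} refl refl = ⟦⟧-+ a b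

  hom-- : ∀ {a b x y} → ⟦ a ⟧ ≡ x → ⟦ b ⟧ ≡ y → ⟦ a - b ⟧ ≡ x ⊟ y
  hom-- {a} {b} refl refl = trans (⟦⟧-+ a (- b)) (cong (⟦ a ⟧ ⊞_) (⟦⟧-neg b))

  hom-* : ∀ {a b x y} → ⟦ a ⟧ ≡ x → ⟦ b ⟧ ≡ y → ⟦ a * b ⟧ ≡ x ⊠ y
  hom-* {a} {b} refl refl = ⟦⟧-* a b

  rhsE-curve : ∀ k x → ⟦ rhsE (toℤ k) (toℤ x) ⟧ ≡ curve k x
  rhsE-curve k x = hom-+ (hom-+
      (hom-* (hom-* (hom-* (hom-* {+ 4} refl k′) x′) x′) x′)
      (hom-* (hom-* (hom-- (hom-- (hom-* k′ k′) (hom-* {+ 6} refl k′)) (refl {x = ⟦ + 3 ⟧})) x′) x′))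
    (hom-* {+ 4} refl x′)
    where
    k′ : ⟦ toℤ k ⟧ ≡ k
    k′ = ⟦⟧-toℤ k
    x′ : ⟦ toℤ x ⟧ ≡ x
    x′ = ⟦⟧-toℤ x

  numPoints-∑ : ∀ k → numPoints p (toℕ k) ≡ + 1 + ∑ λ x → roots (curve k x)
  numPoints-∑ k = cong (_+_ (+ 1)) (trans
    (∑-sumℕ λ x → sumℕ p λ y → if modZ p (+ y * + y - rhsE (toℤ k) (+ x)) == 0 then + 1 else + 0)
    (∑-cong λ x → trans
      (∑-sumℕ λ y → if modZ p (+ y * + y - rhsE (toℤ k) (toℤ x)) == 0 then + 1 else + 0)
      (∑-cong λ y → trans (if-== {y = 0#}
          (λ eq → trans (sym (point x y))
              (Fin.toℕ-injective (trans (toℕ-⟦⟧ (toℤ y * toℤ y - rhsE (toℤ k) (toℤ x)))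
              (trans eq (sym toℕ-0#)))))
          (λ eq → trans (sym (toℕ-⟦⟧ (toℤ y * toℤ y - rhsE (toℤ k) (toℤ x))))
              (trans (cong toℕ (trans (point x y) eq)) toℕ-0#)) (+ 1))
        (trans (ℤ.*-identityʳ (δ (y ⊠ y ⊟ curve k x) 0#)) (δ-⇔ ⊟≡0⇒≡ ≡⇒⊟≡0)))))
    where
    point : ∀ x y → ⟦ toℤ y * toℤ y - rhsE (toℤ k) (toℤ x) ⟧ ≡ y ⊠ y ⊟ curve k x
    point x y = hom-- (hom-* (⟦⟧-toℤ y) (⟦⟧-toℤ y)) (rhsE-curve k x)

  -- Extends a_p(E_k) + 1 from k ≠ 0, 1 to all k, so that its square can be summed over the whole
  -- field.
  b : F → ℤ
  b k = + p - + 4 - n k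

  ap-b : ∀ k → k ≢ 0# → k ≢ 1# → ap p (toℕ k) + + 1 ≡ b k
  ap-b k k≢0 k≢1 = trans (cong (λ N → + p + + 1 - N + + 1) (numPoints-∑ k))
    (trans (lem (+ p) (∑ λ x → roots (curve k x)))
      (cong (λ m → + p - + 4 - m) (sym (trans (n-generic k k≢0 k≢1) (cong (_- + 5) (∑-cubic k k≢0))))))
    where
    lem : ∀ p s → p + + 1 - (+ 1 + s) + + 1 ≡ p - + 4 - (s - + 5)
    lem = solve-∀

  sumFromTo-2-∑ : ∀ (f : ℕ → ℤ) → sumFromTo 2 q f ≡ ∑ (f ∘ toℕ) - f (toℕ 0#) - f (toℕ 1#)
  sumFromTo-2-∑ f = trans (sumFromTo-2 q f (ℕ.≤-trans (s≤s z≤n) (ℕ.s≤s⁻¹ 5≤p)))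
    (cong₂ _-_ (cong₂ _-_ (∑-sumℕ f) (cong f (sym toℕ-0#))) (cong f (sym toℕ-1#)))

  -- Both sides are the sum of B over k ≠ 0, 1, 9; T and B need not agree at 0 and 1, which the
  -- trace sum omits. No term is removed twice because 0, 1 and 9 are distinct modulo p.
  ∑-exclude : ∀ (T B : F → ℤ) → (∀ k → k ≡ ⟦ + 9 ⟧ → T k ≡ + 0) →
              (∀ k → k ≢ 0# → k ≢ 1# → k ≢ ⟦ + 9 ⟧ → T k ≡ B k) →
              ∑ T - T 0# - T 1# ≡ ∑ B - B 0# - B 1# - B ⟦ + 9 ⟧
  ∑-exclude T B at-9 elsewhere = begin
    ∑ T - T 0# - T 1#
      ≡⟨ remove {λ k → T k - δ k 0# * T k} {T} (remove {T} {T} refl 0#) 1# ⟨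
    ∑ (λ k → T k - δ k 0# * T k - δ k 1# * T k)
      ≡⟨ ∑-cong (λ k → pointwise k (k ≟ 0#) (k ≟ 1#) (k ≟ ⟦ + 9 ⟧)) ⟩
    ∑ (λ k → B k - δ k 0# * B k - δ k 1# * B k - δ k ⟦ + 9 ⟧ * B k)
      ≡⟨ remove {λ k → B k - δ k 0# * B k - δ k 1# * B k} {B}
           (remove {λ k → B k - δ k 0# * B k} {B} (remove {B} {B} refl 0#) 1#) ⟦ + 9 ⟧ ⟩
    ∑ B - B 0# - B 1# - B ⟦ + 9 ⟧ ∎
    where
    open ≡-Reasoning
    remove : ∀ {f g : F → ℤ} {s} → ∑ f ≡ s → ∀ a → ∑ (λ k → f k - δ k a * g k) ≡ s - g a
    remove {f} {g} eq a = trans (∑-- f (λ k → δ k a * g k)) (cong₂ _-_ eq (∑-δ a g))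
    value : ∀ {x y z x′ y′ z′ : ℤ} t u → x ≡ x′ → y ≡ y′ → z ≡ z′ →
            t - x′ * t - y′ * t ≡ u - x′ * u - y′ * u - z′ * u →
            t - x * t - y * t ≡ u - x * u - y * u - z * u
    value t u refl refl refl h = h
    first : ∀ t u → t - + 1 * t - + 0 * t ≡ u - + 1 * u - + 0 * u - + 0 * u
    first = solve-∀
    second : ∀ t u → t - + 0 * t - + 1 * t ≡ u - + 0 * u - + 1 * u - + 0 * u
    second = solve-∀
    third : ∀ u → + 0 ≡ u - + 0 * u - + 0 * u - + 1 * u
    third = solve-∀
    fourth : ∀ u → u - + 0 * u - + 0 * u ≡ u - + 0 * u - + 0 * u - + 0 * u
    fourth = solve-∀
    pointwise : ∀ k → Dec (k ≡ 0#) → Dec (k ≡ 1#) → Dec (k ≡ ⟦ + 9 ⟧) →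
      T k - δ k 0# * T k - δ k 1# * T k ≡ B k - δ k 0# * B k - δ k 1# * B k - δ k ⟦ + 9 ⟧ * B k
    pointwise k (yes refl) _ _ =
      value (T k) (B k) (δ-yes {0#} refl) (δ-no (1≢0 ∘ sym)) (δ-no (9≢0 ∘ sym)) (first (T k) (B k))
    pointwise k (no k≢0) (yes refl) _ =
      value (T k) (B k) (δ-no 1≢0) (δ-yes {1#} refl) (δ-no (9≢1 ∘ sym)) (second (T k) (B k))
    pointwise k (no k≢0) (no k≢1) (yes k≡9) = value (T k) (B k) (δ-no k≢0) (δ-no k≢1) (δ-yes k≡9)
      (trans (cong (λ t → t - + 0 * t - + 0 * t) (at-9 k k≡9)) (third (B k)))
    pointwise k (no k≢0) (no k≢1) (no k≢9) = value (T k) (B k) (δ-no k≢0) (δ-no k≢1) (δ-no k≢9)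
      (trans (cong (λ t → t - + 0 * t - + 0 * t) (elsewhere k k≢0 k≢1 k≢9)) (fourth (B k)))

  traceSum-b : traceSum p ≡ ∑ (λ k → b k * b k) - b 0# * b 0# - b 1# * b 1# - b ⟦ + 9 ⟧ * b ⟦ + 9 ⟧
  traceSum-b = trans (sumFromTo-2-∑ term)
    (∑-exclude (λ k → term (toℕ k)) (λ k → b k * b k) term-9 term-b)
    where
    term : ℕ → ℤ
    term k = if modN p k == modN p 9 then + 0 else (ap p k + + 1) * (ap p k + + 1)
    term-9 : ∀ k → k ≡ ⟦ + 9 ⟧ → term (toℕ k) ≡ + 0
    term-9 k k≡9 = if-yes {a = + 0} {(ap p (toℕ k) + + 1) * (ap p (toℕ k) + + 1)}
      (trans (ℕ.m<n⇒m%n≡m (Fin.toℕ<n k)) (trans (cong toℕ k≡9) (⟦⟧-+-toℕ 9)))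
    term-b : ∀ k → k ≢ 0# → k ≢ 1# → k ≢ ⟦ + 9 ⟧ → term (toℕ k) ≡ b k * b k
    term-b k k≢0 k≢1 k≢9 = trans
      (if-no {a = + 0} {(ap p (toℕ k) + + 1) * (ap p (toℕ k) + + 1)} λ eq → k≢9 (Fin.toℕ-injective
        (trans (sym (ℕ.m<n⇒m%n≡m (Fin.toℕ<n k))) (trans eq (sym (⟦⟧-+-toℕ 9))))))
      (cong (λ a → a * a) (ap-b k k≢0 k≢1))

  -- Evaluation of the second moment and of V(0) - V(1)

  -- Nonzero scalars act freely on the sextuples with both sums zero, so q divides their number;
  -- this is the quotient.
  N′ : ℤ
  N′ = + q * (ρ * ρ) + n 0# * n 0# + ∑ (λ k → n k * n k)

  count-6-N′ : count 6 0# 0# ≡ + q * N′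
  count-6-N′ = trans count-6 (trans (cong (λ c → c * c + + q * (n 0# * n 0#) + + q * ∑ (λ k → n k * n k))
      count-3-00)
    (lem (+ q) ρ (n 0# * n 0#) (∑ λ k → n k * n k)))
    where
    lem : ∀ q r a s → q * r * (q * r) + q * a + q * s ≡ q * (q * (r * r) + a + s)
    lem = solve-∀

  ∑-b² : ∑ (λ k → b k * b k) ≡ (+ p - + 4) * (+ p - + 4) * + p - + 2 * (+ p - + 4) * ∑ n + ∑ (λ k → n k * n k)
  ∑-b² = begin
    ∑ (λ k → b k * b k)
      ≡⟨ ∑-cong (λ k → expand (+ p - + 4) (n k)) ⟩
    ∑ (λ k → (c * c - + 2 * c * n k) + n k * n k)
      ≡⟨ ∑-+ (λ k → c * c - + 2 * c * n k) (λ k → n k * n k) ⟩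
    ∑ (λ k → c * c - + 2 * c * n k) + ∑ (λ k → n k * n k)
      ≡⟨ cong (_+ ∑ (λ k → n k * n k)) (trans (∑-- (λ _ → c * c) (λ k → + 2 * c * n k))
          (cong₂ _-_ (∑-const (c * c)) (∑-*ˡ (+ 2 * c) n))) ⟩
    c * c * + p - + 2 * c * ∑ n + ∑ (λ k → n k * n k) ∎
    where
    open ≡-Reasoning
    c : ℤ
    c = + p - + 4
    expand : ∀ c n → (c - n) * (c - n) ≡ (c * c - + 2 * c * n) + n * n
    expand = solve-∀

  -- Makes the result linear in ρ, as it must be to match a single term in (p/3).
  ρ² : ρ * ρ ≡ + 2 * ρ
  ρ² = by-cases ρ-values
    where
    by-cases : ρ ≡ + 0 ⊎ ρ ≡ + 2 → ρ * ρ ≡ + 2 * ρ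
    by-cases (inj₁ ρ≡0) = trans (cong (λ r → r * r) ρ≡0) (sym (cong (+ 2 *_) ρ≡0))
    by-cases (inj₂ ρ≡2) = trans (cong (λ r → r * r) ρ≡2) (sym (cong (+ 2 *_) ρ≡2))

  -- The terms missing from the trace sum are restored by b(0) = ρ - 2, b(1) = 2 - 2p and b(9) = ρ.
  -- All quadratic terms in ρ then combine to (p + 2)(ρ² - 2ρ) = 0.
  N′-value : N′ ≡ traceSum p + + p * + p * + p - + p * + p + + 2 * + p - + 12 + + 4 * ρ
  N′-value = trans (cong₂ (λ x s → + q * (ρ * ρ) + x * x + s) n-0 ∑-n²)
    (trans (collect (+ q) ρ (traceSum p)) (trans (cong (λ r → closed + (+ p + + 2) * (r - + 2 * ρ)) ρ²)
      (absorb closed (+ p + + 2) ρ)))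
    where
    open ≡-Reasoning
    closed : ℤ
    closed = traceSum p + + p * + p * + p - + p * + p + + 2 * + p - + 12 + + 4 * ρ
    absorb : ∀ x y r → x + y * (+ 2 * r - + 2 * r) ≡ x
    absorb = solve-∀
    collect : ∀ q r t →
      q * (r * r) + ((+ 1 + q) - + 2 - r) * ((+ 1 + q) - + 2 - r)
          + ((t + (((+ 1 + q) - + 4) - ((+ 1 + q) - + 4 - r)) * (((+ 1 + q) - + 4) - ((+ 1 + q) - + 4 - r))
          + (((+ 1 + q) - + 4) - (+ 3 * (+ 1 + q) - + 6)) * (((+ 1 + q) - + 4) - (+ 3 * (+ 1 + q) - + 6))
          + (((+ 1 + q) - + 4) - ((+ 1 + q) - + 2 - r)) * (((+ 1 + q) - + 4) - ((+ 1 + q) - + 2 - r))) -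
          ((+ 1 + q) - + 4) * ((+ 1 + q) - + 4) * (+ 1 + q) + + 2 * ((+ 1 + q) - + 4) *
          (q * (q * + 1) - (q * + 1 - (+ 1 - + 0))))
      ≡ t + (+ 1 + q) * (+ 1 + q) * (+ 1 + q) - (+ 1 + q) * (+ 1 + q) + + 2 * (+ 1 + q) - + 12 + + 4 * r
          + ((+ 1 + q) + + 2) * (r * r - + 2 * r)
    collect = solve-∀
    c m : ℤ
    c = + p - + 4
    m = (+ q) ^ 2 - ((+ q) ^ 1 - ((+ q) ^ 0 - + 0))
    solve-n² : ∀ x s c p m → s ≡ c * c * p - + 2 * c * m + x → x ≡ s - c * c * p + + 2 * c * m
    solve-n² x s c p m refl = lem x c p m
      where
      lem : ∀ x c p m → x ≡ (c * c * p - + 2 * c * m + x) - c * c * p + + 2 * c * m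
      lem = solve-∀
    solve-b² : ∀ t s x y z → t ≡ s - x * x - y * y - z * z → s ≡ t + z * z + y * y + x * x
    solve-b² t s x y z refl = lem s x y z
      where
      lem : ∀ s x y z → s ≡ (s - x * x - y * y - z * z) + z * z + y * y + x * x
      lem = solve-∀
    ∑-n² : ∑ (λ k → n k * n k) ≡
      (traceSum p + (c - (+ p - + 4 - ρ)) * (c - (+ p - + 4 - ρ)) + (c - (+ 3 * + p - + 6)) *
          (c - (+ 3 * + p - + 6)) + (c - (+ p - + 2 - ρ)) * (c - (+ p - + 2 - ρ))) - c * c * + p + + 2 * c * m
    ∑-n² = begin
      ∑ (λ k → n k * n k)
        ≡⟨ solve-n² (∑ λ k → n k * n k) (∑ λ k → b k * b k) (+ p - + 4) (+ p) (∑ n) ∑-b² ⟩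
      ∑ (λ k → b k * b k) - c * c * + p + + 2 * c * ∑ n
        ≡⟨ cong₂ (λ s m → s - c * c * + p + + 2 * c * m)
             (solve-b² (traceSum p) (∑ λ k → b k * b k) (b 0#) (b 1#) (b ⟦ + 9 ⟧) traceSum-b) ∑-n ⟩
      (traceSum p + b ⟦ + 9 ⟧ * b ⟦ + 9 ⟧ + b 1# * b 1# + b 0# * b 0#) - c * c * + p + + 2 * c * m
        ≡⟨ cong (λ x → (traceSum p + (c - x) * (c - x) + b 1# * b 1# + b 0# * b 0#) - c * c * + p + + 2 * c * m)
            n-9 ⟩
      (traceSum p + (c - (+ p - + 4 - ρ)) * (c - (+ p - + 4 - ρ)) + b 1# * b 1# + b 0# * b 0#) - c * c * + p
          + + 2 * c * m
        ≡⟨ cong₂ (λ x y → (traceSum p + (c - (+ p - + 4 - ρ)) * (c - (+ p - + 4 - ρ)) + (c - x) * (c - x)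
            + (c - y) * (c - y)) - c * c * + p + + 2 * c * m) n-1 n-0 ⟩
      (traceSum p + (c - (+ p - + 4 - ρ)) * (c - (+ p - + 4 - ρ)) + (c - (+ 3 * + p - + 6)) *
          (c - (+ 3 * + p - + 6))
          + (c - (+ p - + 2 - ρ)) * (c - (+ p - + 2 - ρ))) - c * c * + p + + 2 * c * m ∎

  -- The p⁵ in p²N′ cancels against the leading term of (p - 1)⁵, and 4ρ = 4 + 4(p/3) yields the
  -- Legendre term.
  V-difference : V 0# - V 1# ≡ rhsV6 p
  V-difference = trans (moment N′ count-6-N′) (trans
    (cong (λ N → + p * + p * N - (+ q) ^ 5 - + 2) (trans N′-value
      (cong (λ r → traceSum p + + p * + p * + p - + p * + p + + 2 * + p - + 12 + + 4 * r) ρ≡1+legendre3)))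
    (collect (+ q) (legendre3 p) (traceSum p)))
    where
    collect : ∀ q l t →
      (+ 1 + q) * (+ 1 + q) * (t + (+ 1 + q) * (+ 1 + q) * (+ 1 + q) - (+ 1 + q) * (+ 1 + q) + + 2 * (+ 1 + q) -
          + 12 + + 4 * (+ 1 + l))
        - q * (q * (q * (q * (q * + 1)))) - + 2
      ≡ + 4 * (+ 1 + q) * (+ 1 + q) * (+ 1 + q) * (+ 1 + q) - + 8 * (+ 1 + q) * (+ 1 + q) * (+ 1 + q)
        + (+ 4 * l + + 2) * (+ 1 + q) * (+ 1 + q) - + 5 * (+ 1 + q) - + 1 + (+ 1 + q) * (+ 1 + q) * t
    collect = solve-∀

theorem1 : (p : ℕ) → Prime p → 5 ≤ p → V6 p ≈⟨ p ⟩ constGR p (rhsV6 p)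
theorem1 (suc q) p-prime 5≤p = V6-constant V-difference
  where open Kloosterman q p-prime 5≤p
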